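{- For any constant $\varepsilon>0$, there is a deterministic \textsf{CONGEST} algorithm that, on any $n$-vertex graph with maximum degree $\Delta$ whose vertices have unique $O(\log n)$-bit identifiers, computes a proper vertex coloring with $O(\Delta^{1+\varepsilon})$ colors in $O(\Delta^{1/2-\varepsilon/2})+\log^* n$ rounds.
   Context: The \textsf{CONGEST} model: synchronous rounds on the network graph, in each round every vertex may send one $O(\log n)$-bit message to each neighbor; vertices initially know their own identifier (and $\Delta$, $n$); at the end each vertex knows its own color. $\log^* n$ denotes the iterated logarithm.
   Formalization: The constant ε is taken to be a positive rational p/q rather than an arbitrary positive real; the bounds on colors and rounds are stated as the equivalent inequalities between integer powers, with max(1,Δ) in place of Δ. -}

module Defs where

open import Data.Nat using (ℕ; zero; suc; _+_; _*_; _∸_; _^_; _≤_; _<_; _⊔_; _≤ᵇ_)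
open import Data.Nat.Logarithm using (⌊log₂_⌋)
open import Data.Bool using (if_then_else_)
open import Data.Fin using (Fin; _≟_)
open import Data.List using (List; []; _∷_; length)
open import Data.List.Membership.Propositional using (_∈_; _∉_)
open import Data.List.Relation.Unary.Unique.Propositional using (Unique)
open import Data.Maybe using (Maybe; just; nothing; _>>=_)
open import Data.Product using (Σ; ∃; _×_)
open import Relation.Binary.PropositionalEquality using (_≡_; _≢_)
open import Relation.Nullary using (does)
open import Function.Definitions using (Injective)

-- Iterated logarithm (base 2): log* n = 0 if n ≤ 1, else 1 + log*(⌊log₂ n⌋).
-- Fuel n suffices since ⌊log₂ n⌋ < n for n ≥ 2.

logStarFuel : ℕ → ℕ → ℕ
logStarFuel zero    n = 0
logStarFuel (suc f) n = if n ≤ᵇ 1 then 0 else suc (logStarFuel f ⌊log₂ n ⌋)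

logStar : ℕ → ℕ
logStar n = logStarFuel n n

-- Finite simple graphs on vertex set Fin n, given by neighbour lists.
-- The order of the neighbour list of v is v's (arbitrary) port numbering.

record Graph (n : ℕ) : Set where
  field
    nbrs   : Fin n → List (Fin n)
    unique : ∀ v → Unique (nbrs v)
    sym    : ∀ u v → u ∈ nbrs v → v ∈ nbrs u
    irrefl : ∀ v → v ∉ nbrs v

  deg : Fin n → ℕ
  deg v = length (nbrs v)

  Adj : Fin n → Fin n → Set
  Adj u v = u ∈ nbrs v

MaxDegree : ∀ {n} → Graph n → ℕ → Set
MaxDegree G Δ = (∀ v → deg v ≤ Δ) × (∃ λ v → deg v ≡ Δ)
  where open Graph G

lookupMaybe : ∀ {A : Set} → List A → ℕ → Maybe A
lookupMaybe []       _       = nothing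
lookupMaybe (x ∷ xs) zero    = just x
lookupMaybe (x ∷ xs) (suc i) = lookupMaybe xs i

indexOf : ∀ {n} → Fin n → List (Fin n) → ℕ
indexOf v []       = 0
indexOf v (x ∷ xs) = if does (v Data.Fin.≟ x) then 0 else suc (indexOf v xs)

-- Deterministic synchronous message-passing algorithms (CONGEST).
-- Unbounded local computation; in each round a vertex sends on each port
-- (= index into its neighbour list) an optional message (a natural number),
-- then updates its state from the messages received on each port.
-- Vertices initially know n, Δ, their identifier and their degree.
-- Every vertex runs for 'rounds n Δ' rounds (computable by every vertex)
-- and then outputs its colour.

record Algorithm : Set₁ where
  field
    State  : Set
    init   : (n Δ ident degree : ℕ) → State
    send   : State → ℕ → Maybe ℕ
    step   : State → (ℕ → Maybe ℕ) → State
    rounds : ℕ → ℕ → ℕ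
    output : State → ℕ

module Run (A : Algorithm) {n : ℕ} (G : Graph n) (Δ : ℕ) (ident : Fin n → ℕ) where
  open Algorithm A
  open Graph G

  inbox : (Fin n → State) → Fin n → ℕ → Maybe ℕ
  inbox st v i = lookupMaybe (nbrs v) i >>= λ u → send (st u) (indexOf v (nbrs u))

  state : ℕ → Fin n → State
  state zero    v = init n Δ (ident v) (deg v)
  state (suc t) v = step (state t v) (inbox (state t) v)

  T : ℕ
  T = rounds n Δ

  colour : Fin n → ℕ
  colour v = output (state T v)

  -- every message actually sent (on a real port, in a round < T) has
  -- O(log n) bits, i.e. is < (n+1)^k
  Bandwidth : ℕ → Set
  Bandwidth k = ∀ t v j m → t < T → j < deg v →
                send (state t v) j ≡ just m → m < suc n ^ k

  Proper : Set
  Proper = ∀ u v → Adj u v → colour u ≢ colour v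

-- The algorithm A, with message constant k and hidden constant C, for
-- ε = p / q and identifiers of at most c·log n bits (ids < (n+1)^c):
--   * colours lie in [0, K) with K ≤ C · max(1,Δ)^(1+ε)
--       expressed as  colour^q < C^q · D^(q+p),  D = max(1,Δ);
--   * rounds ≤ C · D^(1/2 - ε/2) + log* n
--       expressed as  r^(2q) · D^(p∸q) ≤ C^(2q) · D^(q∸p),  r = rounds ∸ log* n.

Solves : Algorithm → (p q c k C : ℕ) → Set
Solves A p q c k C =
  ∀ n Δ (G : Graph n) (ident : Fin n → ℕ) →
  MaxDegree G Δ →
  Injective _≡_ _≡_ ident →
  (∀ v → ident v < suc n ^ c) →
  let open Run A G Δ ident
      D = Δ ⊔ 1
      r = T ∸ logStar n
  in Bandwidth k
   × Proper
   × (∀ v → colour v ^ q < C ^ q * D ^ (q + p))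
   × (r ^ (2 * q) * D ^ (p ∸ q) ≤ C ^ (2 * q) * D ^ (q ∸ p))

{-# OPTIONS --safe #-}

-- Reading a colour in base Q, for a prime Q, as a polynomial over ℤ/Q, distinct colours agree
-- at few points. If Q exceeds the number of possible agreements with all neighbours, some
-- point x is free of them and (x , f(x)) is a new colour (Linial). Iterating with Q of order
-- Δ log m takes m colours to O(Δ⁴) in log* n − 1 rounds, and a last step with four digits
-- gives O(Δ²), which settles ε ≥ 1.
--
-- For ε < 1 let s be of order Δ^((1−ε)/2) and β = Δ / s. In a prime number P = O(s) of
-- trials every vertex tries the values of its polynomial over ℤ/P in turn, and keeps the
-- first one that at most β neighbours hold or try at the same time. Averaging over the
-- trials shows that everybody succeeds, which partitions the graph into P classes whose
-- edges are oriented (towards earlier trials) with out-degree at most β.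
-- The classes are then coloured one after the other from ℤ/Q × ℤ/Q with a prime Q of order
-- β + s: the at most Δ colours already used around a vertex are spread over the Q translates
-- of its polynomial, so some translate f meets at most s of them, and some x is free of
-- these as well as of the agreements of f with the translates chosen by the out-neighbours.
--
-- Primes are available up to a constant factor by the argument of Erdős, with the valuation
-- of the central binomial coefficient bounded through Leibniz' harmonic triangle.
module Submission where

open import Defs
open import Data.Bool as Bool using (true; false; if_then_else_)
open import Data.Empty using (⊥; ⊥-elim)
open import Data.Fin using (Fin)
open import Data.Fin.Properties using (injective⇒≤)
open import Data.Integer as ℤ using (ℤ; 0ℤ) renaming (+_ to pos)
import Data.Integer.Divisibility.Signed as ℤ∣
import Data.Integer.Properties as ℤ
import Data.Integer.Tactic.RingSolver as ℤSolver
open import Data.List using (List; []; _∷_; _++_; length; map; lookup)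
open import Data.List.Membership.Propositional using (_∈_)
open import Data.List.Membership.Propositional.Properties using (∈-map⁺; ∈-map⁻; ∈-lookup)
open import Data.List.Properties using (length-++; length-map)
open import Data.List.Relation.Unary.All as All using (All; []; _∷_)
open import Data.List.Relation.Unary.AllPairs using ([]; _∷_)
open import Data.List.Relation.Unary.Any using (here; there)
open import Data.List.Relation.Unary.Unique.Propositional using (Unique)
open import Data.Maybe using (Maybe; just; nothing; _>>=_)
open import Data.Maybe.Properties using (just-injective)
open import Data.Nat
open import Data.Nat.DivMod using (_/_; _%_; m≡m%n+[m/n]*n; m%n<n; m/n*n≤m; m*n/n≡m; m<n*o⇒m/o<n; m<n⇒m%n≡m; m<n⇒m/n≡0; [m+kn]%n≡m%n; +-distrib-/-∣ˡ)
import Data.Nat.Divisibility as ℕ∣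
open import Data.Nat.Induction using (<-rec)
open import Data.Nat.Logarithm using (⌊log₂_⌋; ⌊log₂⌋-mono-≤; ⌊log₂⌊n/2⌋⌋≡⌊log₂n⌋∸1)
open import Data.Nat.Primality using (Prime; prime?; prime[2]; ¬prime[0]; ¬prime[1]; prime⇒nonZero; prime⇒irreducible; euclidsLemma)
open import Data.Nat.Properties
open import Data.Nat.Tactic.RingSolver using (solve-∀)
open import Data.Product using (Σ; _×_; _,_; proj₁; proj₂)
open import Data.Sum using (_⊎_; inj₁; inj₂)
open import Data.Unit using (tt)
open import Function using (_∘_)
open import Function.Definitions using (Injective)
open import Relation.Binary.Definitions using (tri<; tri≈; tri>)
open import Relation.Binary.PropositionalEquality
open import Relation.Nullary using (Dec; yes; no; ¬_; contradiction)
open import Relation.Nullary.Decidable using (_×-dec_; toWitness)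

-- The coefficient of log* n is exactly 1, and for ε > 1 the remaining bound C · Δ^((1-ε)/2) falls
-- below a single round once Δ is large. So the reduction to O(Δ²) colours must take exactly log* n
-- rounds: its recursion copies that of `logStar`, the last of these rounds is spent on the step
-- with four digits, and all constants are moved into the number of colours. The parameter s
-- balances two costs: three rounds for each of the P = O(s) classes against Q² = O((β + s)²)
-- colours, where β s is about Δ. With s about Δ^((1-ε)/2), β is about Δ^((1+ε)/2) and dominates s,
-- and its square is Δ^(1+ε). Both costs are governed by the sizes of primes, which must therefore
-- be found within a constant factor. The field ℤ/P of the trials is small, yet its polynomials must
-- tell O(Δ²) colours apart. As ε = p/q < 1 is fixed, P is at least of order Δ^(1/(2q)), so a number
-- of digits depending only on q is enough, and two polynomials agree at O(1) points.

module Primes where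
  open import Data.Nat.Divisibility
  open import Data.Nat.Primality.Factorisation using (factorise)
  open import Data.Nat.ListAction using (product)
  open import Data.Nat.Combinatorics using (_C_; nCk+nC[k+1]≡[n+1]C[k+1])

  -- Binomial coefficients and Leibniz' harmonic triangle

  absorption : ∀ n k → suc k * (suc n C suc k) ≡ suc n * (n C k)
  absorption zero zero = refl
  absorption zero (suc k) = trans (cong (suc (suc k) *_) (sym (nCk+nC[k+1]≡[n+1]C[k+1] 0 (suc k))))
      (*-zeroʳ (suc (suc k)))
  absorption (suc n) zero = trans (cong (1 *_) (sym (nCk+nC[k+1]≡[n+1]C[k+1] (suc n) 0)))
    (trans (cong (λ t → 1 * (1 + t)) (trans (sym (*-identityˡ _)) (absorption n 0)))
           (ar n))
    where
    ar : ∀ n → 1 * (1 + suc n * 1) ≡ suc (suc n) * 1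
    ar = solve-∀
  absorption (suc n) (suc k) = begin
    suc (suc k) * (suc (suc n) C suc (suc k))
      ≡⟨ cong (suc (suc k) *_) (nCk+nC[k+1]≡[n+1]C[k+1] (suc n) (suc k)) ⟨
    suc (suc k) * (suc n C suc k + suc n C suc (suc k))
      ≡⟨ ar₁ k (suc n C suc k) (suc n C suc (suc k)) ⟩
    suc n C suc k + suc k * (suc n C suc k) + suc (suc k) * (suc n C suc (suc k))
      ≡⟨ cong₂ (λ a b → suc n C suc k + a + b) (absorption n k) (absorption n (suc k)) ⟩
    suc n C suc k + suc n * (n C k) + suc n * (n C suc k)
      ≡⟨ ar₂ n (suc n C suc k) (n C k) (n C suc k) ⟩
    suc n C suc k + suc n * (n C k + n C suc k)
      ≡⟨ cong (λ t → suc n C suc k + suc n * t) (nCk+nC[k+1]≡[n+1]C[k+1] n k) ⟩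
    suc n C suc k + suc n * (suc n C suc k) ∎
    where
    open ≡-Reasoning
    ar₁ : ∀ k a b → suc (suc k) * (a + b) ≡ a + suc k * a + suc (suc k) * b
    ar₁ = solve-∀
    ar₂ : ∀ n s a b → s + suc n * a + suc n * b ≡ s + suc n * (a + b)
    ar₂ = solve-∀

  nCk≤2^n : ∀ n k → n C k ≤ 2 ^ n
  nCk≤2^n n zero = m^n>0 2 n
  nCk≤2^n zero (suc k) = z≤n
  nCk≤2^n (suc n) (suc k) = begin
    suc n C suc k          ≡⟨ nCk+nC[k+1]≡[n+1]C[k+1] n k ⟨
    n C k + n C suc k      ≤⟨ +-mono-≤ (nCk≤2^n n k) (nCk≤2^n n (suc k)) ⟩
    2 ^ n + 2 ^ n          ≡⟨ cong (2 ^ n +_) (+-identityʳ (2 ^ n)) ⟨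
    2 ^ suc n ∎
    where open ≤-Reasoning

  nCk≤[1+n]Ck : ∀ n k → n C k ≤ suc n C k
  nCk≤[1+n]Ck n zero = ≤-refl
  nCk≤[1+n]Ck n (suc k) = ≤-trans (m≤n+m (n C suc k) (n C k)) (≤-reflexive (nCk+nC[k+1]≡[n+1]C[k+1] n k))

  -- Two applications of Pascal's rule show that the central coefficient at least doubles. The true
  -- growth is about 4^n; the loss only enlarges the constant factor between a number and the prime
  -- found above it.
  2^n≤[n+n]Cn : ∀ n → 2 ^ n ≤ (n + n) C n
  2^n≤[n+n]Cn zero = ≤-refl
  2^n≤[n+n]Cn (suc n) = begin
    2 * 2 ^ n ≡⟨ cong (2 ^ n +_) (+-identityʳ (2 ^ n)) ⟩
    2 ^ n + 2 ^ n ≤⟨ +-mono-≤ le ge ⟩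
    (n + suc n) C n + (n + suc n) C suc n ≡⟨ nCk+nC[k+1]≡[n+1]C[k+1] (n + suc n) n ⟩
    suc (n + suc n) C suc n ∎
    where
    open ≤-Reasoning
    le : 2 ^ n ≤ (n + suc n) C n
    le = begin
      2 ^ n ≤⟨ 2^n≤[n+n]Cn n ⟩
      (n + n) C n ≤⟨ nCk≤[1+n]Ck (n + n) n ⟩
      suc (n + n) C n ≡⟨ cong (_C n) (+-suc n n) ⟨
      (n + suc n) C n ∎
    ge : 2 ^ n ≤ (n + suc n) C suc n
    ge = begin
      2 ^ n ≤⟨ 2^n≤[n+n]Cn n ⟩
      (n + n) C n ≤⟨ m≤m+n _ _ ⟩
      (n + n) C n + (n + n) C suc n ≡⟨ nCk+nC[k+1]≡[n+1]C[k+1] (n + n) n ⟩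
      suc (n + n) C suc n ≡⟨ cong (_C suc n) (+-suc n n) ⟨
      (n + suc n) C suc n ∎

  nCk>0 : ∀ {n k} → k ≤ n → 0 < n C k
  nCk>0 {n} {zero} _ = s≤s z≤n
  nCk>0 {suc n} {suc k} (s≤s k≤n) = ≤-trans (nCk>0 k≤n)
    (≤-trans (m≤m+n _ _) (≤-reflexive (nCk+nC[k+1]≡[n+1]C[k+1] n k)))

  -- The reciprocals of the numbers (n + 1) C(n, k) form Leibniz' harmonic triangle:
  -- each entry is the sum of the two below it.
  leibniz : ∀ M n k → k ≤ n → (∀ j → j ≤ n → suc j ∣ M) → suc n * (n C k) ∣ M
  leibniz M n zero _ h = subst (_∣ M) (sym (*-identityʳ (suc n))) (h n ≤-refl)
  leibniz M (suc n) (suc k) (s≤s k≤n) h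
    with leibniz M n k k≤n (λ j j≤n → h j (m≤n⇒m≤1+n j≤n)) | leibniz M (suc n) k (m≤n⇒m≤1+n k≤n) h
  -- With `a`, `b`, `c` as below, 1/a = 1/b + 1/c, hence M/c = M/a - M/b = x - y.
  ... | divides x M≡xa | divides y M≡yb = divides (x ∸ y) (sym [x∸y]c≡M)
    where
    N = suc n
    a = N * (n C k)
    b = suc N * (N C k)
    c = suc N * (N C suc k)
    ab+ac≡bc : a * b + a * c ≡ b * c
    ab+ac≡bc = begin
      a * b + a * c ≡⟨ ar₁ a (suc N) (N C k) (N C suc k) ⟩
      a * (suc N * (N C k + N C suc k)) ≡⟨ cong (λ t → a * (suc N * t)) (nCk+nC[k+1]≡[n+1]C[k+1] N k) ⟩
      a * (suc N * (suc N C suc k)) ≡⟨ cong (_* (suc N * (suc N C suc k))) (absorption n k) ⟨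
      suc k * (N C suc k) * (suc N * (suc N C suc k)) ≡⟨ ar₂ (suc k) (N C suc k) (suc N) (suc N C suc k) ⟩
      (suc k * (suc N C suc k)) * (suc N * (N C suc k)) ≡⟨ cong (_* c) (absorption N k) ⟩
      b * c ∎
      where
      open ≡-Reasoning
      ar₁ : ∀ a n p q → a * (n * p) + a * (n * q) ≡ a * (n * (p + q))
      ar₁ = solve-∀
      ar₂ : ∀ k p n q → k * p * (n * q) ≡ (k * q) * (n * p)
      ar₂ = solve-∀
    instance
      ab≢0 : NonZero (a * b)
      ab≢0 = >-nonZero (*-mono-≤ {1} {a} {1} {b} (*-mono-≤ {1} {N} {1} (s≤s z≤n) (nCk>0 k≤n))
                                   (*-mono-≤ {1} {suc N} {1} (s≤s z≤n) (nCk>0 (m≤n⇒m≤1+n k≤n))))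
    [x∸y]c≡M : (x ∸ y) * c ≡ M
    [x∸y]c≡M = *-cancelʳ-≡ ((x ∸ y) * c) M (a * b) (begin
      (x ∸ y) * c * (a * b) ≡⟨ *-assoc (x ∸ y) c (a * b) ⟩
      (x ∸ y) * (c * (a * b)) ≡⟨ *-distribʳ-∸ (c * (a * b)) x y ⟩
      x * (c * (a * b)) ∸ y * (c * (a * b)) ≡⟨ cong₂ _∸_ (ar₃ x a b c) (ar₄ y a b c) ⟩
      (x * a) * (b * c) ∸ (y * b) * (a * c) ≡⟨ cong₂ (λ s t → s * (b * c) ∸ t * (a * c)) (sym M≡xa) (sym M≡yb) ⟩
      M * (b * c) ∸ M * (a * c) ≡⟨ *-distribˡ-∸ M (b * c) (a * c) ⟨
      M * (b * c ∸ a * c) ≡⟨ cong (λ t → M * (t ∸ a * c)) ab+ac≡bc ⟨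
      M * (a * b + a * c ∸ a * c) ≡⟨ cong (M *_) (m+n∸n≡m (a * b) (a * c)) ⟩
      M * (a * b) ∎)
      where
      open ≡-Reasoning
      ar₃ : ∀ x a b c → x * (c * (a * b)) ≡ (x * a) * (b * c)
      ar₃ = solve-∀
      ar₄ : ∀ y a b c → y * (c * (a * b)) ≡ (y * b) * (a * c)
      ar₄ = solve-∀

  -- By absorption, (k + 1) · C(k + 1 + j, k + 1) = (k + 1 + j) · C(k + j, k). The right side is
  -- divisible by `p`, either by induction or because k + 1 + j is `p` itself, and k + 1 < p cannot
  -- carry this factor.
  prime∣C : ∀ {p} k j → Prime p → p ≤ k + j → k < p → j < p → p ∣ (k + j) C k
  prime∣C zero j pr p≤ k<p j<p = contradiction p≤ (<⇒≱ j<p)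
  prime∣C {p} (suc k) j pr p≤ k<p j<p with euclidsLemma (suc k) (suc (k + j) C suc k) pr
      (subst (p ∣_) (sym (absorption (k + j) k)) top)
    where
    top : p ∣ suc (k + j) * ((k + j) C k)
    top with m≤n⇒m<n∨m≡n p≤
    ... | inj₁ (s≤s p≤k+j) = ∣n⇒∣m*n (suc (k + j)) (prime∣C k j pr p≤k+j (<-trans ≤-refl k<p) j<p)
    ... | inj₂ refl = m∣m*n _
  ... | inj₁ p∣k = contradiction (∣⇒≤ p∣k) (<⇒≱ k<p)
  ... | inj₂ p∣C = p∣C

  -- Products of primes in an interval

  mulIfPrime : ℕ → ℕ → ℕ
  mulIfPrime q r with prime? q
  ... | yes _ = q * r
  ... | no  _ = r

  -- The primes taken are those in (m, m + l]; for `m = 0` this is the primorial of `l`.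
  primeProduct : ℕ → ℕ → ℕ
  primeProduct m zero = 1
  primeProduct m (suc l) = mulIfPrime (m + suc l) (primeProduct m l)

  prime>1 : ∀ {p} → Prime p → 1 < p
  prime>1 {suc (suc p)} _ = s≤s (s≤s z≤n)
  prime>1 {0} pr = ⊥-elim (¬prime[0] pr)
  prime>1 {1} pr = ⊥-elim (¬prime[1] pr)

  ∤-primeProduct : ∀ {p} m l → Prime p → m + l < p → p ∤ primeProduct m l
  ∤-primeProduct m zero pr m<p p∣ = <⇒≢ (prime>1 pr) (sym (∣1⇒≡1 p∣))
  ∤-primeProduct {p} m (suc l) pr m<p p∣ with prime? (m + suc l)
  ... | no _ = ∤-primeProduct m l pr (≤-trans (s≤s (+-monoʳ-≤ m (n≤1+n l))) m<p) p∣
  ... | yes pr′ with euclidsLemma (m + suc l) _ pr p∣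
  ...   | inj₁ p∣q = contradiction (∣⇒≤ {{prime⇒nonZero pr′}} p∣q) (<⇒≱ m<p)
  ...   | inj₂ p∣r = ∤-primeProduct m l pr (≤-trans (s≤s (+-monoʳ-≤ m (n≤1+n l))) m<p) p∣r

  -- The largest prime exceeds all others in the product, so it does not divide their product and
  -- must divide the cofactor.
  primeProduct-∣ : ∀ m l X → (∀ p → Prime p → m < p → p ≤ m + l → p ∣ X) → primeProduct m l ∣ X
  primeProduct-∣ m zero X h = 1∣ X
  primeProduct-∣ m (suc l) X h
    with prime? (m + suc l) | primeProduct-∣ m l X (λ p pr m<p p≤ → h p pr m<p (≤-trans p≤ (+-monoʳ-≤ m (n≤1+n l))))
  ... | no _ | d = d
  ... | yes pr | divides t refl with euclidsLemma t (primeProduct m l) pr (h _ pr (m<m+n m (s≤s z≤n)) ≤-refl)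
  ...   | inj₁ p∣t = *-monoˡ-∣ (primeProduct m l) p∣t
  ...   | inj₂ p∣r = contradiction p∣r (∤-primeProduct m l pr (+-monoʳ-< m ≤-refl))

  ∣-primeProduct : ∀ {p} l → Prime p → p ≤ l → p ∣ primeProduct 0 l
  ∣-primeProduct zero pr z≤n = ⊥-elim (¬prime[0] pr)
  ∣-primeProduct (suc l) pr p≤ with prime? (suc l) | m≤n⇒m<n∨m≡n p≤
  ... | yes _ | inj₁ (s≤s p≤l) = ∣n⇒∣m*n (suc l) (∣-primeProduct l pr p≤l)
  ... | no _  | inj₁ (s≤s p≤l) = ∣-primeProduct l pr p≤l
  ... | yes _ | inj₂ refl = m∣m*n _
  ... | no ¬pr | inj₂ refl = contradiction pr ¬pr

  primeProduct-+ : ∀ m l → primeProduct 0 (m + l) ≡ primeProduct 0 m * primeProduct m l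
  primeProduct-+ m zero = trans (cong (primeProduct 0) (+-identityʳ m)) (sym (*-identityʳ _))
  primeProduct-+ m (suc l) = begin
    primeProduct 0 (m + suc l) ≡⟨ cong (primeProduct 0) (+-suc m l) ⟩
    mulIfPrime (suc (m + l)) (primeProduct 0 (m + l)) ≡⟨ cong₂ mulIfPrime (sym (+-suc m l)) (primeProduct-+ m l) ⟩
    mulIfPrime (m + suc l) (primeProduct 0 m * primeProduct m l) ≡⟨ move (m + suc l) (primeProduct 0 m)
        (primeProduct m l) ⟩
    primeProduct 0 m * primeProduct m (suc l) ∎
    where
    open ≡-Reasoning
    ar : ∀ s a b → s * (a * b) ≡ a * (s * b)
    ar = solve-∀
    move : ∀ q a b → mulIfPrime q (a * b) ≡ a * mulIfPrime q b
    move q a b with prime? q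
    ... | yes _ = ar q a b
    ... | no _ = refl

  primeProduct≤C : ∀ m → primeProduct m m ≤ (m + m) C m
  primeProduct≤C m = ∣⇒≤ {{>-nonZero (nCk>0 (m≤m+n m m))}}
    (primeProduct-∣ m m _ (λ p pr m<p p≤ → prime∣C m m pr p≤ m<p m<p))

  2^[1+k]≡2^k+2^k : ∀ k → 2 ^ suc k ≡ 2 ^ k + 2 ^ k
  2^[1+k]≡2^k+2^k k = cong (2 ^ k +_) (+-identityʳ (2 ^ k))

  -- Chebyshev's doubling argument: the primes in (2^k, 2^(k+1)] divide a central binomial
  -- coefficient, which is at most 2^(2^(k+1)), and the exponents form a geometric series.
  primorial-bound : ∀ k → primeProduct 0 (2 ^ k) ≤ 2 ^ (2 ^ suc k)
  primorial-bound zero = s≤s z≤n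
  primorial-bound (suc k) = begin
    primeProduct 0 (2 ^ suc k) ≡⟨ cong (primeProduct 0) (2^[1+k]≡2^k+2^k k) ⟩
    primeProduct 0 (2 ^ k + 2 ^ k) ≡⟨ primeProduct-+ (2 ^ k) (2 ^ k) ⟩
    primeProduct 0 (2 ^ k) * primeProduct (2 ^ k) (2 ^ k)
      ≤⟨ *-mono-≤ (primorial-bound k) (≤-trans (primeProduct≤C (2 ^ k)) (nCk≤2^n (2 ^ k + 2 ^ k) (2 ^ k))) ⟩
    2 ^ (2 ^ suc k) * 2 ^ (2 ^ k + 2 ^ k) ≡⟨ cong (λ t → 2 ^ (2 ^ suc k) * 2 ^ t) (2^[1+k]≡2^k+2^k k) ⟨
    2 ^ (2 ^ suc k) * 2 ^ (2 ^ suc k) ≡⟨ ^-distribˡ-+-* 2 (2 ^ suc k) (2 ^ suc k) ⟨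
    2 ^ (2 ^ suc k + 2 ^ suc k) ≡⟨ cong (2 ^_) (2^[1+k]≡2^k+2^k (suc k)) ⟨
    2 ^ (2 ^ suc (suc k)) ∎
    where open ≤-Reasoning

  -- A common multiple assembled from prime powers

  largestPower : ℕ → ℕ → ℕ → ℕ
  largestPower N m zero = 1
  largestPower N m (suc e) with m ^ suc e ≤? N
  ... | yes _ = m ^ suc e
  ... | no _ = largestPower N m e

  largestPower≤ : ∀ N m e → 1 ≤ N → largestPower N m e ≤ N
  largestPower≤ N m zero 1≤N = 1≤N
  largestPower≤ N m (suc e) 1≤N with m ^ suc e ≤? N
  ... | yes le = le
  ... | no _ = largestPower≤ N m e 1≤N

  ^-monoʳ-∣ : ∀ m {a b} → a ≤ b → m ^ a ∣ m ^ b
  ^-monoʳ-∣ m {a} {b} a≤b = subst (λ t → m ^ a ∣ m ^ t) (m+[n∸m]≡n a≤b)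
    (subst (m ^ a ∣_) (sym (^-distribˡ-+-* m a (b ∸ a))) (m∣m*n (m ^ (b ∸ a))))

  ∣-largestPower : ∀ N m f e → e ≤ f → m ^ e ≤ N → m ^ e ∣ largestPower N m f
  ∣-largestPower N m zero zero z≤n le = ∣-refl
  ∣-largestPower N m (suc f) e e≤f le with m ^ suc f ≤? N | m≤n⇒m<n∨m≡n e≤f
  ... | yes _ | _ = ^-monoʳ-∣ m e≤f
  ... | no ¬le | inj₁ (s≤s e≤f′) = ∣-largestPower N m f e e≤f′ le
  ... | no ¬le | inj₂ refl = contradiction le ¬le

  -- Every base up to `w` contributes, prime or not. The resulting bound `N ^ w` is good enough when
  -- `w` is about the square root of `N`, and no primes have to be counted.
  powerProduct : ℕ → ℕ → ℕ
  powerProduct N zero = 1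
  powerProduct N (suc w) = largestPower N (suc w) N * powerProduct N w

  powerProduct≤ : ∀ N w → 1 ≤ N → powerProduct N w ≤ N ^ w
  powerProduct≤ N zero _ = ≤-refl
  powerProduct≤ N (suc w) h = *-mono-≤ (largestPower≤ N (suc w) N h) (powerProduct≤ N w h)

  n<2^n : ∀ n → n < 2 ^ n
  n<2^n zero = s≤s z≤n
  n<2^n (suc n) = begin-strict
    suc n ≡⟨ +-comm 1 n ⟩
    n + 1 <⟨ +-mono-<-≤ (n<2^n n) (m^n>0 2 n) ⟩
    2 ^ n + 2 ^ n ≡⟨ 2^[1+k]≡2^k+2^k n ⟨
    2 ^ suc n ∎
    where open ≤-Reasoning

  ∣-powerProduct : ∀ N w p e → 1 < p → p ≤ w → p ^ e ≤ N → p ^ e ∣ powerProduct N w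
  ∣-powerProduct N zero p e 1<p p≤w le = contradiction (≤-trans 1<p p≤w) λ()
  ∣-powerProduct N (suc w) p e 1<p p≤w le with m≤n⇒m<n∨m≡n p≤w
  ... | inj₁ (s≤s p≤w′) = ∣n⇒∣m*n (largestPower N (suc w) N) (∣-powerProduct N w p e 1<p p≤w′ le)
  ... | inj₂ refl = ∣m⇒∣m*n (powerProduct N w) (∣-largestPower N p N e e≤N le)
    where
    e≤N : e ≤ N
    e≤N = ≤-trans (<⇒≤ (n<2^n e)) (≤-trans (^-monoˡ-≤ e 1<p) le)

  primePower-∣-cancel : ∀ {p q} e y → Prime p → Prime q → q ≢ p → q ^ e ∣ p * y → q ^ e ∣ y
  primePower-∣-cancel zero y pp pq q≢p d = 1∣ y
  primePower-∣-cancel {p} {q} (suc e) y pp pq q≢p d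
    with primePower-∣-cancel e y pp pq q≢p (∣-trans (^-monoʳ-∣ q (n≤1+n e)) d)
  ... | divides z refl with euclidsLemma p z pq
          (*-cancelʳ-∣ (q ^ e) {{m^n≢0 q e {{prime⇒nonZero pq}}}}
              (subst (q ^ suc e ∣_) (sym (*-assoc p z (q ^ e))) d))
  ...   | inj₂ q∣z = *-monoˡ-∣ (q ^ e) q∣z
  ...   | inj₁ q∣p with prime⇒irreducible pp q∣p
  ...     | inj₁ refl = ⊥-elim (¬prime[1] pq)
  ...     | inj₂ q≡p = contradiction q≡p q≢p

  -- Both sides are divided by the head `p`. For `q = p` the hypothesis is used with the exponent
  -- raised by one; for any other prime the factor `p` is cancelled from the multiple.
  product-∣ : ∀ ps → All Prime ps → ∀ M → (∀ q e → Prime q → q ^ e ∣ product ps → q ^ e ∣ M) → product ps ∣ M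
  product-∣ [] [] M h = 1∣ M
  product-∣ (p ∷ ps) (pp ∷ pps) M h
    with h p 1 pp (subst (_∣ p * product ps) (sym (*-identityʳ p)) (m∣m*n (product ps)))
  ... | divides t M≡ = subst (p * product ps ∣_) (sym (trans M≡tp (*-comm t p)))
      (*-monoʳ-∣ p (product-∣ ps pps t h′))
    where
    M≡tp : M ≡ t * p
    M≡tp = trans M≡ (cong (t *_) (*-identityʳ p))
    h′ : ∀ q e → Prime q → q ^ e ∣ product ps → q ^ e ∣ t
    h′ q e pq d with q ≟ p
    ... | yes refl = *-cancelˡ-∣ q {{prime⇒nonZero pq}}
            (subst (q ^ suc e ∣_) (trans M≡tp (*-comm t q)) (h q (suc e) pq (*-monoʳ-∣ q d)))
    ... | no q≢p = primePower-∣-cancel e t pp pq q≢p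
            (subst (q ^ e ∣_) (trans M≡tp (*-comm t p)) (h q e pq (∣n⇒∣m*n p d)))

  ∣-byPrimePowers : ∀ j .{{_ : NonZero j}} M → (∀ q e → Prime q → q ^ e ∣ j → q ^ e ∣ M) → j ∣ M
  ∣-byPrimePowers j M h with factorise j
  ... | record { factors = ps ; isFactorisation = refl ; factorsPrime = all } = product-∣ ps all M h

  module _ (x w : ℕ) (1≤x : 1 ≤ x) (1≤w : 1 ≤ w) (noPrime : ∀ p → Prime p → x < p → p ≤ w * w → ⊥) where
    private
      N = w * w
      M = primeProduct 0 x * powerProduct N w

    -- A prime up to `w` may occur in `suc j` with any power up to `N`, which `powerProduct`
    -- supplies. A prime above `w` occurs at most once, since its square exceeds `N`, and by
    -- `noPrime` it is at most `x`, so the primorial supplies it.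
    commonMultiple : ∀ j → j < N → suc j ∣ M
    commonMultiple j j<N = ∣-byPrimePowers (suc j) M primePower
      where
      primePower : ∀ q e → Prime q → q ^ e ∣ suc j → q ^ e ∣ M
      primePower q zero pq d = 1∣ M
      primePower q (suc e) pq d with q ≤? w
      ... | yes q≤w = ∣n⇒∣m*n (primeProduct 0 x)
              (∣-powerProduct N w q (suc e) (prime>1 pq) q≤w (≤-trans (∣⇒≤ d) j<N))
      primePower q (suc zero) pq d | no q≰w = ∣m⇒∣m*n _ (subst (_∣ primeProduct 0 x) (sym (*-identityʳ q)) q∣)
        where
        q≤N : q ≤ N
        q≤N = ≤-trans (≤-reflexive (sym (*-identityʳ q))) (≤-trans (∣⇒≤ d) j<N)
        q∣ : q ∣ primeProduct 0 x
        q∣ with q ≤? x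
        ... | yes q≤x = ∣-primeProduct x pq q≤x
        ... | no q≰x = ⊥-elim (noPrime q pq (≰⇒> q≰x) q≤N)
      primePower q (suc (suc e)) pq d | no q≰w = contradiction (≤-trans (∣⇒≤ d) j<N) (<⇒≱ (begin-strict
        w * w <⟨ *-mono-< (≰⇒> q≰w) (≰⇒> q≰w) ⟩
        q * q ≡⟨ cong (q *_) (*-identityʳ q) ⟨
        q ^ 2 ≤⟨ ^-monoʳ-≤ q {{prime⇒nonZero pq}} (s≤s (s≤s (z≤n {e}))) ⟩
        q ^ suc (suc e) ∎))
        where open ≤-Reasoning

    private
      largestPower>0 : ∀ N m e .{{_ : NonZero m}} → 0 < largestPower N m e
      largestPower>0 N m zero = s≤s z≤n
      largestPower>0 N m (suc e) with m ^ suc e ≤? N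
      ... | yes _ = m^n>0 m (suc e)
      ... | no _ = largestPower>0 N m e

      powerProduct>0 : ∀ N w → 0 < powerProduct N w
      powerProduct>0 N zero = s≤s z≤n
      powerProduct>0 N (suc w) = *-mono-≤ {1} {largestPower N (suc w) N} {1} (largestPower>0 N (suc w) N)
          (powerProduct>0 N w)

      primeProduct>0 : ∀ m l → 0 < primeProduct m l
      primeProduct>0 m zero = s≤s z≤n
      primeProduct>0 m (suc l) with prime? (m + suc l)
      ... | yes pr = *-mono-≤ {1} {m + suc l} {1} (<⇒≤ (prime>1 pr)) (primeProduct>0 m l)
      ... | no _ = primeProduct>0 m l

    -- Absorption turns n · C(2n, n) into an entry of the Leibniz triangle in a row below `N`, which
    -- divides the common multiple `M`. This takes the place of computing the valuations of the
    -- central coefficient.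
    no-prime⇒central-small : ∀ n → n + n ≡ N → 2 ^ n ≤ primeProduct 0 x * N ^ w
    no-prime⇒central-small zero eq = contradiction (≤-trans (*-mono-≤ 1≤w 1≤w) (≤-reflexive (sym eq))) λ()
    no-prime⇒central-small (suc n) eq = begin
      2 ^ suc n ≤⟨ 2^n≤[n+n]Cn (suc n) ⟩
      (suc n + suc n) C suc n ≤⟨ m≤n*m _ (suc n) ⟩
      suc n * (suc (n + suc n) C suc n) ≡⟨ absorption (n + suc n) n ⟩
      suc (n + suc n) * ((n + suc n) C n) ≤⟨ ∣⇒≤ {{>-nonZero
          (*-mono-≤ {1} {_} {1} (primeProduct>0 0 x) (powerProduct>0 N w))}}
                             (leibniz M (n + suc n) n (m≤m+n n (suc n))
                                 (λ j j≤ → commonMultiple j (≤-trans (s≤s j≤) (≤-reflexive eq)))) ⟩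
      primeProduct 0 x * powerProduct N w ≤⟨ *-monoʳ-≤ (primeProduct 0 x) (powerProduct≤ N w (*-mono-≤ 1≤w 1≤w)) ⟩
      primeProduct 0 x * N ^ w ∎
      where open ≤-Reasoning

  -- For j = i + 3 this reads 4(j + 2) < 3 · 2^j, the final comparison of exponents. It fails for j
  -- = 2 (16 against 12), hence the explicit primes for j ≤ 2 in `primeAfterPower`.
  4[i+5]<3·2^[i+3] : ∀ i → 4 * (i + 5) < 3 * 2 ^ (i + 3)
  4[i+5]<3·2^[i+3] zero = toWitness {a? = 20 <? 24} _
  4[i+5]<3·2^[i+3] (suc i) = begin-strict
    4 * suc (i + 5) ≡⟨ ar₁ i ⟩
    4 * (i + 5) + 4 <⟨ +-mono-<-≤ (4[i+5]<3·2^[i+3] i) four ⟩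
    3 * 2 ^ (i + 3) + 3 * 2 ^ (i + 3) ≡⟨ ar₂ (2 ^ (i + 3)) ⟩
    3 * 2 ^ suc (i + 3) ∎
    where
    open ≤-Reasoning
    ar₁ : ∀ i → 4 * suc (i + 5) ≡ 4 * (i + 5) + 4
    ar₁ = solve-∀
    ar₂ : ∀ t → 3 * t + 3 * t ≡ 3 * (2 * t)
    ar₂ = solve-∀
    four : 4 ≤ 3 * 2 ^ (i + 3)
    four = ≤-trans (≤-trans (m≤m+n 4 16) (*-monoʳ-≤ 4 (m≤n+m 5 i))) (<⇒≤ (4[i+5]<3·2^[i+3] i))

  4^k≡2^[k+k] : ∀ k → 4 ^ k ≡ 2 ^ (k + k)
  4^k≡2^[k+k] k = trans (^-*-assoc 2 2 k) (cong (2 ^_) (cong (k +_) (+-identityʳ k)))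

  module _ (i : ℕ) where
    private
      j = i + 3
      u = 2 ^ j
      w = 4 * u
      x = 4 ^ j
      N = w * w

      x≡uu : x ≡ u * u
      x≡uu = trans (4^k≡2^[k+k] j) (^-distribˡ-+-* 2 j j)

      N≡ : N ≡ 2 ^ (2 * (j + 2))
      N≡ = trans (ar u) (trans (cong₂ _*_ (sym (^-distribˡ-+-* 2 j 2)) (sym (^-distribˡ-+-* 2 j 2)))
             (trans (sym (^-distribˡ-+-* 2 (j + 2) (j + 2)))
                 (cong (λ t → 2 ^ (j + 2 + t)) (sym (+-identityʳ (j + 2))))))
        where
        ar : ∀ u → 4 * u * (4 * u) ≡ u * 4 * (u * 4)
        ar = solve-∀

      -- The exponents of 2 are 2u² for the primorial and 8(j + 2)u for the prime powers, against
      -- 8u² for the central coefficient. The search interval ends at 16x because with 4x the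
      -- leading terms would both be 2u².
      small : primeProduct 0 x * N ^ w < 2 ^ (8 * (u * u))
      small = begin-strict
        primeProduct 0 x * N ^ w ≡⟨ cong₂ (λ a b → primeProduct 0 a * b ^ w) (4^k≡2^[k+k] j) N≡ ⟩
        primeProduct 0 (2 ^ (j + j)) * (2 ^ (2 * (j + 2))) ^ w
          ≤⟨ *-mono-≤ (primorial-bound (j + j)) (≤-reflexive (^-*-assoc 2 (2 * (j + 2)) w)) ⟩
        2 ^ (2 ^ suc (j + j)) * 2 ^ (2 * (j + 2) * w) ≡⟨ ^-distribˡ-+-* 2 (2 ^ suc (j + j)) (2 * (j + 2) * w) ⟨
        2 ^ (2 ^ suc (j + j) + 2 * (j + 2) * w) <⟨ ^-monoʳ-< 2 (s≤s (s≤s z≤n)) expo ⟩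
        2 ^ (8 * (u * u)) ∎
        where
        open ≤-Reasoning
        expo : 2 ^ suc (j + j) + 2 * (j + 2) * w < 8 * (u * u)
        expo = begin-strict
          2 ^ suc (j + j) + 2 * (j + 2) * w ≡⟨ cong (λ t → 2 * t + 2 * (j + 2) * w) (^-distribˡ-+-* 2 j j) ⟩
          2 * (u * u) + 2 * (j + 2) * (4 * u) ≡⟨ cong (2 * (u * u) +_) (ar₁ i u) ⟩
          2 * (u * u) + (2 * u) * (4 * (i + 5)) <⟨ +-monoʳ-< (2 * (u * u))
              (*-monoʳ-< (2 * u) {{m*n≢0 2 u {{_}} {{m^n≢0 2 j}}}} (4[i+5]<3·2^[i+3] i)) ⟩
          2 * (u * u) + (2 * u) * (3 * u) ≡⟨ ar₂ u ⟩
          8 * (u * u) ∎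
          where
          ar₁ : ∀ i u → 2 * (i + 3 + 2) * (4 * u) ≡ (2 * u) * (4 * (i + 5))
          ar₁ = solve-∀
          ar₂ : ∀ u → 2 * (u * u) + (2 * u) * (3 * u) ≡ 8 * (u * u)
          ar₂ = solve-∀

    primeAfterPower′ : Σ ℕ λ p → Prime p × 4 ^ j < p × p ≤ 16 * 4 ^ j
    primeAfterPower′ with anyUpTo? (λ p → prime? p ×-dec (4 ^ j <? p)) (suc N)
    ... | yes (p , s≤s p≤N , pr , x<p) = p , pr , x<p , subst (p ≤_) (trans (ar u) (cong (16 *_) (sym x≡uu))) p≤N
      where
      ar : ∀ u → 4 * u * (4 * u) ≡ 16 * (u * u)
      ar = solve-∀
    ... | no none = contradiction (no-prime⇒central-small x w (m^n>0 4 j) (*-mono-≤ {1} {4} (s≤s z≤n) (m^n>0 2 j))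
                        (λ p pr x<p p≤N → none (p , s≤s p≤N , pr , x<p)) (8 * (u * u)) (ar u)) (<⇒≱ small)
      where
      ar : ∀ u → 8 * (u * u) + 8 * (u * u) ≡ 4 * u * (4 * u)
      ar = solve-∀

  primeAfterPower : ∀ j → Σ ℕ λ p → Prime p × 4 ^ j < p × p ≤ 16 * 4 ^ j
  primeAfterPower 0 = 2 , prime[2] , s≤s (s≤s z≤n) , toWitness {a? = 2 ≤? 16} _
  primeAfterPower 1 = 5 , toWitness {a? = prime? 5} _ , ≤-refl , toWitness {a? = 5 ≤? 64} _
  primeAfterPower 2 = 17 , toWitness {a? = prime? 17} _ , ≤-refl , toWitness {a? = 17 ≤? 256} _
  primeAfterPower (suc (suc (suc i))) = subst (λ j → Σ ℕ λ p → Prime p × 4 ^ j < p × p ≤ 16 * 4 ^ j)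
      (+-comm i 3) (primeAfterPower′ i)

  betweenPowers : ∀ b → 2 ≤ b → ∀ y → Σ ℕ λ j → suc y < b ^ suc j × b ^ j ≤ suc y
  betweenPowers b 2≤b zero = 0 , ≤-trans 2≤b (≤-reflexive (sym (*-identityʳ b))) , ≤-refl
  betweenPowers b 2≤b (suc y) with betweenPowers b 2≤b y
  ... | j , y< , ≤y with suc (suc y) <? b ^ suc j
  ...   | yes lt = j , lt , m≤n⇒m≤1+n ≤y
  ...   | no ≮ = suc j , ≤-<-trans y< (<-≤-trans (m<m*n (b ^ suc j) b
      {{m^n≢0 b (suc j) {{>-nonZero (<⇒≤ 2≤b)}}}} 2≤b) (≤-reflexive (*-comm (b ^ suc j) b))) , ≮⇒≥ ≮

  abstract
    -- The factor 64 is 4 for rounding up to a power of 4 times 16 for the search interval above it.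
    bertrand : ∀ y → 1 ≤ y → Σ ℕ λ p → Prime p × y < p × p ≤ 64 * y
    bertrand (suc y) _ with betweenPowers 4 (s≤s (s≤s z≤n)) y
    ... | j , y< , ≤y with primeAfterPower (suc j)
    ...   | p , pr , <p , p≤ = p , pr , <-trans y< <p , (begin
        p ≤⟨ p≤ ⟩
        16 * (4 * 4 ^ j) ≡⟨ *-assoc 16 4 (4 ^ j) ⟨
        64 * 4 ^ j ≤⟨ *-monoʳ-≤ 64 ≤y ⟩
        64 * suc y ∎)
      where open ≤-Reasoning

  abstract
    -- Total in `y`, because programs choose their primes before anything is known to be positive;
    -- only the upper bound asks for positivity.
    primeAbove : ∀ y → Σ ℕ λ p → Prime p × y < p × (1 ≤ y → p ≤ 64 * y)
    primeAbove zero = 2 , prime[2] , s≤s z≤n , λ ()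
    primeAbove (suc y) = weaken (bertrand (suc y) (s≤s z≤n))
      where
      weaken : (Σ ℕ λ p → Prime p × suc y < p × p ≤ 64 * suc y) → Σ ℕ λ p → Prime p × suc y < p ×
          (1 ≤ suc y → p ≤ 64 * suc y)
      weaken (p , pr , y< , p≤) = p , pr , y< , λ _ → p≤

open Primes using (primeAbove; prime>1; betweenPowers; n<2^n; 2^[1+k]≡2^k+2^k)
open ℤ∣ using (_∣_; _∣?_; divides)

-- Averaging over finite sums

indicator : ∀ {P : Set} → Dec P → ℕ
indicator (yes _) = 1
indicator (no _) = 0

indicator≡0⇒¬ : ∀ {P : Set} (d : Dec P) → indicator d ≡ 0 → ¬ P
indicator≡0⇒¬ (no ¬p) _ = ¬p

indicator-mono : ∀ {P R : Set} (d : Dec P) (e : Dec R) → (P → R) → indicator d ≤ indicator e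
indicator-mono (no _) e f = z≤n
indicator-mono (yes p) (yes _) f = ≤-refl
indicator-mono (yes p) (no ¬r) f = contradiction (f p) ¬r

¬⇒indicator≡0 : ∀ {P : Set} (d : Dec P) → ¬ P → indicator d ≡ 0
¬⇒indicator≡0 (yes p) ¬p = contradiction p ¬p
¬⇒indicator≡0 (no _) ¬p = refl

sumBelow : ℕ → (ℕ → ℕ) → ℕ
sumBelow zero f = 0
sumBelow (suc N) f = sumBelow N f + f N

sumOver : ∀ {A : Set} → List A → (A → ℕ) → ℕ
sumOver [] f = 0
sumOver (u ∷ us) f = f u + sumOver us f

sumOver-map : ∀ {A B : Set} (us : List A) (g : A → B) f → sumOver (map g us) f ≡ sumOver us (f ∘ g)
sumOver-map [] g f = refl
sumOver-map (u ∷ us) g f = cong (_ +_) (sumOver-map us g f)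

sumOver-mono : ∀ {A : Set} (us : List A) {f g : A → ℕ} → (∀ u → u ∈ us → f u ≤ g u) → sumOver us f ≤ sumOver us g
sumOver-mono [] h = z≤n
sumOver-mono (u ∷ us) h = +-mono-≤ (h u (here refl)) (sumOver-mono us (λ v v∈ → h v (there v∈)))

sumOver-const : ∀ {A : Set} (us : List A) k → sumOver us (λ _ → k) ≡ length us * k
sumOver-const [] k = refl
sumOver-const (u ∷ us) k = cong (k +_) (sumOver-const us k)

sumOver≤ : ∀ {A : Set} (us : List A) {f : A → ℕ} k → (∀ u → u ∈ us → f u ≤ k) → sumOver us f ≤ length us * k
sumOver≤ us k h = ≤-trans (sumOver-mono us h) (≤-reflexive (sumOver-const us k))

sumOver≡0 : ∀ {A : Set} (us : List A) {f : A → ℕ} → sumOver us f ≡ 0 → ∀ {u} → u ∈ us → f u ≡ 0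
sumOver≡0 (u ∷ us) {f} eq (here refl) = m+n≡0⇒m≡0 (f u) eq
sumOver≡0 (u ∷ us) {f} eq (there u∈) = sumOver≡0 us (m+n≡0⇒n≡0 (f u) eq) u∈

interchange : ∀ a b c d → (a + b) + (c + d) ≡ (a + c) + (b + d)
interchange = solve-∀

sumOver-+ : ∀ {A : Set} (us : List A) (f g : A → ℕ) → sumOver us (λ u → f u + g u) ≡ sumOver us f + sumOver us g
sumOver-+ [] f g = refl
sumOver-+ (u ∷ us) f g = trans (cong (f u + g u +_) (sumOver-+ us f g)) (interchange (f u) (g u) _ _)

sumOver-* : ∀ {A : Set} (us : List A) (f : A → ℕ) k → sumOver us (λ u → f u * k) ≡ sumOver us f * k
sumOver-* [] f k = refl
sumOver-* (u ∷ us) f k = trans (cong (f u * k +_) (sumOver-* us f k)) (sym (*-distribʳ-+ k (f u) (sumOver us f)))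

sumBelow-mono : ∀ N {f g : ℕ → ℕ} → (∀ x → x < N → f x ≤ g x) → sumBelow N f ≤ sumBelow N g
sumBelow-mono zero h = z≤n
sumBelow-mono (suc N) h = +-mono-≤ (sumBelow-mono N (λ x x< → h x (m≤n⇒m≤1+n x<))) (h N ≤-refl)

sumBelow-+ : ∀ N (f g : ℕ → ℕ) → sumBelow N (λ x → f x + g x) ≡ sumBelow N f + sumBelow N g
sumBelow-+ zero f g = refl
sumBelow-+ (suc N) f g = trans (cong (_+ (f N + g N)) (sumBelow-+ N f g))
    (interchange (sumBelow N f) (sumBelow N g) (f N) (g N))

sumBelow≡0 : ∀ N {f : ℕ → ℕ} → (∀ x → x < N → f x ≡ 0) → sumBelow N f ≡ 0
sumBelow≡0 zero h = refl
sumBelow≡0 (suc N) h = cong₂ _+_ (sumBelow≡0 N (λ x x< → h x (m≤n⇒m≤1+n x<))) (h N ≤-refl)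

sumBelow-sumOver : ∀ {A : Set} N (us : List A) (f : A → ℕ → ℕ) →
  sumBelow N (λ x → sumOver us (λ u → f u x)) ≡ sumOver us (λ u → sumBelow N (f u))
sumBelow-sumOver zero us f = sym (trans (sumOver-const us 0) (*-zeroʳ (length us)))
sumBelow-sumOver (suc N) us f = trans (cong (_+ sumOver us (λ u → f u N)) (sumBelow-sumOver N us f))
  (sym (sumOver-+ us (λ u → sumBelow N (f u)) (λ u → f u N)))

sumBelow-unique : ∀ N {P : ℕ → Set} (P? : ∀ x → Dec (P x)) → (∀ x y → x < N → y < N → P x → P y → x ≡ y) →
  sumBelow N (λ x → indicator (P? x)) ≤ 1
sumBelow-unique zero P? h = z≤n
sumBelow-unique (suc N) P? h with P? N
... | no _ = ≤-trans (≤-reflexive (+-identityʳ _)) (sumBelow-unique N P?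
    (λ x y x< y< → h x y (m≤n⇒m≤1+n x<) (m≤n⇒m≤1+n y<)))
... | yes p = ≤-reflexive (cong (_+ 1) (sumBelow≡0 N (λ x x< → ¬⇒indicator≡0 (P? x)
                (λ px → <⇒≢ x< (h x N (m≤n⇒m≤1+n x<) ≤-refl px p)))))

argmin : ℕ → (ℕ → ℕ) → ℕ
-- The dummy value for the empty range is also the correct start: on the range of one point the
-- strict comparison of `f 0` with itself fails and 0 is returned.
argmin zero f = 0
argmin (suc N) f with f N <? f (argmin N f)
... | yes _ = N
... | no _ = argmin N f

argmin≤ : ∀ N f → argmin (suc N) f ≤ N
argmin≤ N f with f N <? f (argmin N f)
... | yes _ = ≤-refl
argmin≤ zero f | no _ = z≤n
argmin≤ (suc N) f | no _ = m≤n⇒m≤1+n (argmin≤ N f)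

argmin< : ∀ N f → 0 < N → argmin N f < N
argmin< (suc N) f _ = s≤s (argmin≤ N f)

argmin-min : ∀ N (f : ℕ → ℕ) x → x < N → f (argmin N f) ≤ f x
argmin-min (suc N) f x x< with f N <? f (argmin N f) | m≤n⇒m<n∨m≡n x<
... | yes lt | inj₁ (s≤s x<N) = ≤-trans (<⇒≤ lt) (argmin-min N f x x<N)
... | yes lt | inj₂ refl = ≤-refl
... | no ≮ | inj₁ (s≤s x<N) = argmin-min N f x x<N
... | no ≮ | inj₂ refl = ≮⇒≥ ≮

N*c≤sumBelow : ∀ N {f} c → (∀ x → x < N → c ≤ f x) → N * c ≤ sumBelow N f
N*c≤sumBelow zero c h = z≤n
N*c≤sumBelow (suc N) c h = ≤-trans (≤-reflexive (+-comm c (N * c)))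
  (+-mono-≤ (N*c≤sumBelow N c (λ x x< → h x (m≤n⇒m≤1+n x<))) (h N ≤-refl))

argmin-average : ∀ N (f : ℕ → ℕ) h → sumBelow N f < N * suc h → f (argmin N f) ≤ h
argmin-average N f h lt with f (argmin N f) ≤? h
... | yes le = le
... | no ≰ = contradiction lt (≤⇒≯ (N*c≤sumBelow N (suc h) (λ x x< → ≤-trans (≰⇒> ≰) (argmin-min N f x x<))))

digit-/ : ∀ a {r} B .{{_ : NonZero B}} → r < B → (a * B + r) / B ≡ a
digit-/ a {r} B r<B = trans (+-distrib-/-∣ˡ r (ℕ∣.n∣m*n a))
    (trans (cong₂ _+_ (m*n/n≡m a B) (m<n⇒m/n≡0 r<B)) (+-identityʳ a))

digit-% : ∀ a {r} B .{{_ : NonZero B}} → r < B → (a * B + r) % B ≡ r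
digit-% a {r} B r<B = trans (cong (_% B) (+-comm (a * B) r)) (trans ([m+kn]%n≡m%n r a B) (m<n⇒m%n≡m r<B))

-- Polynomials over ℤ as coefficient lists, lowest degree first.

eval : List ℤ → ℤ → ℤ
eval [] x = 0ℤ
eval (c ∷ cs) x = c ℤ.+ x ℤ.* eval cs x

-- Coefficients of (p(X) − p(a)) / (X − a) for p = c ∷ cs; they do not depend on c.
divide : ℤ → List ℤ → List ℤ
divide a [] = []
divide a (c ∷ cs) = eval (c ∷ cs) a ∷ divide a cs

length-divide : ∀ a cs → length (divide a cs) ≡ length cs
length-divide a [] = refl
length-divide a (c ∷ cs) = cong suc (length-divide a cs)

eval-divide : ∀ a c cs x → eval (c ∷ cs) x ≡ eval (c ∷ cs) a ℤ.+ (x ℤ.- a) ℤ.* eval (divide a cs) x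
eval-divide a c [] x = ar c a x
  where
  ar : ∀ c a x → c ℤ.+ x ℤ.* 0ℤ ≡ c ℤ.+ a ℤ.* 0ℤ ℤ.+ (x ℤ.- a) ℤ.* 0ℤ
  ar = ℤSolver.solve-∀
eval-divide a c (d ∷ cs) x = trans (cong (λ t → c ℤ.+ x ℤ.* t) (eval-divide a d cs x))
    (ar c a x (eval (d ∷ cs) a) (eval (divide a cs) x))
  where
  ar : ∀ c a x p q → c ℤ.+ x ℤ.* (p ℤ.+ (x ℤ.- a) ℤ.* q) ≡ c ℤ.+ a ℤ.* p ℤ.+ (x ℤ.- a) ℤ.* (p ℤ.+ x ℤ.* q)
  ar = ℤSolver.solve-∀

module _ {Q : ℕ} (Q-prime : Prime Q) where
  private
    instance
      Q≢0 : NonZero Q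
      Q≢0 = prime⇒nonZero Q-prime

  ∣-*-cancel : ∀ x y → ¬ (pos Q ∣ x) → pos Q ∣ x ℤ.* y → pos Q ∣ y
  ∣-*-cancel x y ∤x d with euclidsLemma ℤ.∣ x ∣ ℤ.∣ y ∣ Q-prime
      (subst (Q ℕ∣.∣_) (ℤ.abs-* x y) (ℤ∣.∣⇒∣ᵤ d))
  ... | inj₁ Q∣x = contradiction (ℤ∣.∣ᵤ⇒∣ Q∣x) ∤x
  ... | inj₂ Q∣y = ℤ∣.∣ᵤ⇒∣ Q∣y

  ∤-difference : ∀ {x y} → x < y → y < Q → ¬ (pos Q ∣ pos x ℤ.- pos y)
  ∤-difference {x} {y} x<y y<Q d = contradiction
      (ℕ∣.∣⇒≤ {{>-nonZero (m<n⇒0<n∸m x<y)}} (subst (Q ℕ∣.∣_) eq (ℤ∣.∣⇒∣ᵤ d)))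
      (<⇒≱ (≤-<-trans (m∸n≤m y x) y<Q))
    where
    eq : ℤ.∣ pos x ℤ.- pos y ∣ ≡ y ∸ x
    eq = trans (cong ℤ.∣_∣ (ℤ.m-n≡m⊖n x y)) (ℤ.∣⊖∣-< x<y)

  divide-∣-head : ∀ a cs → All (pos Q ∣_) (divide a cs) → pos Q ∣ eval cs a
  divide-∣-head a [] _ = divides 0ℤ refl
  divide-∣-head a (_ ∷ _) (d ∷ _) = d

  -- The entries of the quotient are the values at `a` of the successive tails, so each coefficient
  -- is one such value minus `a` times the next.
  divide-∣ : ∀ a cs → All (pos Q ∣_) (divide a cs) → All (pos Q ∣_) cs
  divide-∣ a [] _ = []
  divide-∣ a (c ∷ cs) (Q∣p ∷ Q∣s) =
    ℤ∣.∣m+n∣n⇒∣m {m = c} Q∣p (ℤ∣.∣n⇒∣m*n a (divide-∣-head a cs Q∣s)) ∷ divide-∣ a cs Q∣s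

  -- Lagrange's bound on the number of roots over ℤ/Q, phrased by divisibility in ℤ. A root `N` is
  -- divided out; the roots x < N ≤ Q - 1 pass to the quotient because x - N is not divisible by the
  -- prime `Q`.
  manyRoots⇒∣ : ∀ N cs → N ≤ Q → length cs ≤ sumBelow N (λ x → indicator (pos Q ∣? eval cs (pos x))) → All
      (pos Q ∣_) cs
  manyRoots⇒∣ zero [] N≤Q le = []
  manyRoots⇒∣ (suc N) [] N≤Q le = []
  manyRoots⇒∣ (suc N) (c ∷ cs) N<Q le with pos Q ∣? eval (c ∷ cs) (pos N)
  ... | no _ = manyRoots⇒∣ N (c ∷ cs) (<⇒≤ N<Q) (≤-trans le (≤-reflexive (+-identityʳ _)))
  ... | yes Q∣p = ℤ∣.∣m+n∣n⇒∣m {m = c} Q∣p (ℤ∣.∣n⇒∣m*n (pos N) (divide-∣-head (pos N) cs Q∣q)) ∷ divide-∣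
      (pos N) cs Q∣q
    where
    open ≤-Reasoning
    Q∣q : All (pos Q ∣_) (divide (pos N) cs)
    Q∣q = manyRoots⇒∣ N (divide (pos N) cs) (<⇒≤ N<Q) (begin
      length (divide (pos N) cs) ≡⟨ length-divide (pos N) cs ⟩
      length cs ≤⟨ ≤-pred (≤-trans le (≤-reflexive (+-comm _ 1))) ⟩
      sumBelow N (λ x → indicator (pos Q ∣? eval (c ∷ cs) (pos x)))
        ≤⟨ sumBelow-mono N (λ x x<N → indicator-mono (pos Q ∣? eval (c ∷ cs) (pos x))
            (pos Q ∣? eval (divide (pos N) cs) (pos x))
             (λ d → ∣-*-cancel _ _ (∤-difference x<N N<Q)
                (ℤ∣.∣m+n∣m⇒∣n (subst (pos Q ∣_) (eval-divide (pos N) c cs (pos x)) d) Q∣p))) ⟩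
      sumBelow N (λ x → indicator (pos Q ∣? eval (divide (pos N) cs) (pos x))) ∎)

  -- Base-Q digits as polynomials over ℤ/Q

  digitEval : ℕ → ℕ → ℕ → ℕ
  digitEval zero a x = 0
  digitEval (suc d) a x = a % Q + x * digitEval d (a / Q) x

  -- The base-Q digits of a are the coefficients of a polynomial over ℤ/Q.
  hash : ℕ → ℕ → ℕ → ℕ
  hash d a x = digitEval d a x % Q

  hash< : ∀ d a x → hash d a x < Q
  hash< d a x = m%n<n (digitEval d a x) Q

  digitDifferences : ℕ → ℕ → ℕ → List ℤ
  digitDifferences zero a b = []
  digitDifferences (suc d) a b = (pos (a % Q) ℤ.- pos (b % Q)) ∷ digitDifferences d (a / Q) (b / Q)

  length-digitDifferences : ∀ d a b → length (digitDifferences d a b) ≡ d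
  length-digitDifferences zero a b = refl
  length-digitDifferences (suc d) a b = cong suc (length-digitDifferences d (a / Q) (b / Q))

  eval-digitDifferences : ∀ d a b x → eval (digitDifferences d a b) (pos x) ≡ pos (digitEval d a x) ℤ.- pos
      (digitEval d b x)
  eval-digitDifferences zero a b x = refl
  eval-digitDifferences (suc d) a b x = begin
    pos (a % Q) ℤ.- pos (b % Q) ℤ.+ pos x ℤ.* eval (digitDifferences d (a / Q) (b / Q)) (pos x)
      ≡⟨ cong (λ t → pos (a % Q) ℤ.- pos (b % Q) ℤ.+ pos x ℤ.* t) (eval-digitDifferences d (a / Q) (b / Q) x) ⟩
    pos (a % Q) ℤ.- pos (b % Q) ℤ.+ pos x ℤ.* (pos A ℤ.- pos B)
      ≡⟨ ar (pos (a % Q)) (pos (b % Q)) (pos x) (pos A) (pos B) ⟩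
    (pos (a % Q) ℤ.+ pos x ℤ.* pos A) ℤ.- (pos (b % Q) ℤ.+ pos x ℤ.* pos B)
      ≡⟨ cong₂ (λ s t → (pos (a % Q) ℤ.+ s) ℤ.- (pos (b % Q) ℤ.+ t)) (ℤ.pos-* x A) (ℤ.pos-* x B) ⟨
    pos (digitEval (suc d) a x) ℤ.- pos (digitEval (suc d) b x) ∎
    where
    open ≡-Reasoning
    A = digitEval d (a / Q) x
    B = digitEval d (b / Q) x
    ar : ∀ r s x A B → r ℤ.- s ℤ.+ x ℤ.* (A ℤ.- B) ≡ (r ℤ.+ x ℤ.* A) ℤ.- (s ℤ.+ x ℤ.* B)
    ar = ℤSolver.solve-∀

  ∣-difference⇒≡ : ∀ {x y} → x < Q → y < Q → pos Q ∣ pos x ℤ.- pos y → x ≡ y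
  ∣-difference⇒≡ {x} {y} x<Q y<Q d with <-cmp x y
  ... | tri< x<y _ _ = contradiction d (∤-difference x<y y<Q)
  ... | tri≈ _ x≡y _ = x≡y
  ... | tri> _ _ y<x = contradiction (subst (pos Q ∣_) (ar (pos x) (pos y)) (ℤ∣.∣m⇒∣-m d)) (∤-difference y<x x<Q)
    where
    ar : ∀ x y → ℤ.- (x ℤ.- y) ≡ y ℤ.- x
    ar = ℤSolver.solve-∀

  digits-injective : ∀ d {a b} → a < Q ^ d → b < Q ^ d → All (pos Q ∣_) (digitDifferences d a b) → a ≡ b
  digits-injective zero a< b< _ = trans (n<1⇒n≡0 a<) (sym (n<1⇒n≡0 b<))
  digits-injective (suc d) {a} {b} a< b< (Q∣ ∷ Q∣s) = begin
    a ≡⟨ m≡m%n+[m/n]*n a Q ⟩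
    a % Q + a / Q * Q ≡⟨ cong₂ (λ s t → s + t * Q) (∣-difference⇒≡ (m%n<n a Q) (m%n<n b Q) Q∣)
                           (digits-injective d (shrink a<) (shrink b<) Q∣s) ⟩
    b % Q + b / Q * Q ≡⟨ m≡m%n+[m/n]*n b Q ⟨
    b ∎
    where
    open ≡-Reasoning
    shrink : ∀ {a} → a < Q * Q ^ d → a / Q < Q ^ d
    shrink {a} lt = m<n*o⇒m/o<n (subst (a <_) (*-comm Q (Q ^ d)) lt)

  %-≡⇒∣ : ∀ a b → a % Q ≡ b % Q → pos Q ∣ pos a ℤ.- pos b
  %-≡⇒∣ a b eq = divides (pos (a / Q) ℤ.- pos (b / Q)) (begin
    pos a ℤ.- pos b ≡⟨ cong₂ (λ s t → pos s ℤ.- pos t) (m≡m%n+[m/n]*n a Q) (m≡m%n+[m/n]*n b Q) ⟩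
    pos (a % Q + a / Q * Q) ℤ.- pos (b % Q + b / Q * Q)
      ≡⟨ cong₂ (λ s t → (pos (a % Q) ℤ.+ s) ℤ.- (pos (b % Q) ℤ.+ t)) (ℤ.pos-* (a / Q) Q) (ℤ.pos-* (b / Q) Q) ⟩
    (pos (a % Q) ℤ.+ pos (a / Q) ℤ.* pos Q) ℤ.- (pos (b % Q) ℤ.+ pos (b / Q) ℤ.* pos Q)
      ≡⟨ cong (λ t → (pos t ℤ.+ pos (a / Q) ℤ.* pos Q) ℤ.- (pos (b % Q) ℤ.+ pos (b / Q) ℤ.* pos Q)) eq ⟩
    (pos (b % Q) ℤ.+ pos (a / Q) ℤ.* pos Q) ℤ.- (pos (b % Q) ℤ.+ pos (b / Q) ℤ.* pos Q)
      ≡⟨ ar (pos (b % Q)) (pos (a / Q)) (pos (b / Q)) (pos Q) ⟩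
    (pos (a / Q) ℤ.- pos (b / Q)) ℤ.* pos Q ∎)
    where
    open ≡-Reasoning
    ar : ∀ r x y q → (r ℤ.+ x ℤ.* q) ℤ.- (r ℤ.+ y ℤ.* q) ≡ (x ℤ.- y) ℤ.* q
    ar = ℤSolver.solve-∀

  -- An agreement is a root of the difference polynomial. More than `d` roots would make all its d +
  -- 1 coefficients vanish modulo `Q`, and then the two numbers have equal digits.
  hash-agreement : ∀ d {a b} → a ≢ b → a < Q ^ suc d → b < Q ^ suc d →
    sumBelow Q (λ x → indicator (hash (suc d) a x ≟ hash (suc d) b x)) ≤ d
  hash-agreement d {a} {b} a≢b a< b< = ≮⇒≥ (λ d< → a≢b (digits-injective (suc d) a< b<
    (manyRoots⇒∣ Q ds ≤-refl (≤-trans (≤-reflexive (length-digitDifferences (suc d) a b)) (≤-trans d<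
      (sumBelow-mono Q (λ x _ → indicator-mono (hash (suc d) a x ≟ hash (suc d) b x) (pos Q ∣? eval ds (pos x))
        (λ eq → subst (pos Q ∣_) (sym (eval-digitDifferences (suc d) a b x)) (%-≡⇒∣ _ _ eq)))))))))
    where
    ds = digitDifferences (suc d) a b

  digitEval-0 : ∀ d x → digitEval d 0 x ≡ 0
  digitEval-0 zero x = refl
  digitEval-0 (suc d) x = trans (cong₂ (λ s t → s + x * digitEval d t x) (m<n⇒m%n≡m 0<Q) (m<n⇒m/n≡0 0<Q))
     (trans (cong (x *_) (digitEval-0 d x)) (*-zeroʳ x))
    where
    0<Q = n≢0⇒n>0 (≢-nonZero⁻¹ Q)

  -- All higher digits of `y` vanish, so it encodes a constant polynomial. In this way the fixed
  -- class of a settled vertex falls under `hash-agreement`.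
  hash-const : ∀ d {y} x → y < Q → hash (suc d) y x ≡ y
  hash-const d {y} x y<Q = trans (cong (_% Q) (begin
    y % Q + x * digitEval d (y / Q) x ≡⟨ cong₂ (λ s t → s + x * digitEval d t x) (m<n⇒m%n≡m y<Q) (m<n⇒m/n≡0 y<Q) ⟩
    y + x * digitEval d 0 x ≡⟨ cong (λ t → y + x * t) (digitEval-0 d x) ⟩
    y + x * 0 ≡⟨ cong (y +_) (*-zeroʳ x) ⟩
    y + 0 ≡⟨ +-identityʳ y ⟩
    y ∎)) (m<n⇒m%n≡m y<Q)
    where open ≡-Reasoning

  -- Changing the constant coefficient translates the polynomial.
  hash-shift-injective : ∀ d a {σ τ} x → σ < Q → τ < Q → hash (suc d) (a * Q + σ) x ≡ hash (suc d)
      (a * Q + τ) x → σ ≡ τ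
  hash-shift-injective d a {σ} {τ} x σ< τ< eq = ∣-difference⇒≡ σ< τ< (subst (pos Q ∣_) diff (%-≡⇒∣ _ _ eq))
    where
    open ≡-Reasoning
    tail = x * digitEval d a x
    split : ∀ {σ} → σ < Q → digitEval (suc d) (a * Q + σ) x ≡ σ + tail
    split {σ} σ<Q = cong₂ (λ s t → s + x * digitEval d t x)
      (digit-% a Q σ<Q) (digit-/ a Q σ<Q)
    ar : ∀ s t r → (s ℤ.+ r) ℤ.- (t ℤ.+ r) ≡ s ℤ.- t
    ar = ℤSolver.solve-∀
    diff : pos (digitEval (suc d) (a * Q + σ) x) ℤ.- pos (digitEval (suc d) (a * Q + τ) x) ≡ pos σ ℤ.- pos τ
    diff = trans (cong₂ (λ s t → pos s ℤ.- pos t) (split σ<) (split τ<)) (ar (pos σ) (pos τ) (pos tail))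

-- Broadcast programs

-- The public data of a vertex: its initial colour, one plus the trial in which it
-- entered its class, the shift of its polynomial, and one plus the point at which its
-- final colour is read off; 0 stands for "not yet".
record Local : Set where
  constructor local
  field
    label trial shift place : ℕ
open Local

Op : Set
Op = Local → List Local → Local

digit-< : ∀ {a r B C} → a < C → r < B → a * B + r < C * B
digit-< {a} {r} {B} {C} a<C r<B = begin-strict
  a * B + r <⟨ +-monoʳ-< (a * B) r<B ⟩
  a * B + B ≡⟨ +-comm (a * B) B ⟩
  suc a * B ≤⟨ *-monoˡ-≤ B a<C ⟩
  C * B ∎
  where open ≤-Reasoning

BoundedBy : ℕ → Local → Set
BoundedBy B s = label s < B × trial s < B × shift s < B × place s < B

module _ (B : ℕ) .{{_ : NonZero B}} where
  encode : Local → ℕ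
  encode (local a t s p) = ((a * B + t) * B + s) * B + p

  decode : ℕ → Local
  decode m = local (m / B / B / B) (m / B / B % B) (m / B % B) (m % B)

  decode-encode : ∀ s → BoundedBy B s → decode (encode s) ≡ s
  decode-encode (local a t s p) (a< , t< , s< , p<)
    rewrite digit-/ ((a * B + t) * B + s) B p< | digit-% ((a * B + t) * B + s) B p<
          | digit-/ (a * B + t) B s< | digit-% (a * B + t) B s<
          | digit-/ a B t< | digit-% a B t< = refl

  encode-< : ∀ s → BoundedBy B s → encode s < B ^ 4
  encode-< (local a t s p) (a< , t< , s< , p<) = subst (encode (local a t s p) <_) (ar B)
    (digit-< (digit-< (digit-< a< t<) s<) p<)
    where
    ar : ∀ B → B * B * B * B ≡ B * (B * (B * (B * 1)))
    ar = solve-∀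

  collect : ℕ → (ℕ → Maybe ℕ) → List Local
  collect zero f = []
  collect (suc d) f with f 0
  ... | just m = decode m ∷ collect d (f ∘ suc)
  ... | nothing = collect d (f ∘ suc)

  collect-map : ∀ {n} (us : List (Fin n)) (g : Fin n → Maybe ℕ) (h : Fin n → ℕ) → (∀ u → g u ≡ just (h u)) →
    collect (length us) (λ i → lookupMaybe us i >>= g) ≡ map (decode ∘ h) us
  collect-map [] g h eq = refl
  collect-map (u ∷ us) g h eq rewrite eq u = cong (decode (h u) ∷_) (collect-map us g h eq)

module Execution {n : ℕ} (G : Graph n) where
  open Graph G using (nbrs; deg)

  apply : Op → (Fin n → Local) → (Fin n → Local)
  apply o cfg v = o (cfg v) (map cfg (nbrs v))

  -- Weakest precondition: all configurations before the last satisfy I, the last one satisfies Post.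
  Along : ((Fin n → Local) → Set) → List Op → ((Fin n → Local) → Set) → (Fin n → Local) → Set
  Along I [] Post cfg = Post cfg
  Along I (o ∷ os) Post cfg = I cfg × Along I os Post (apply o cfg)

  Along-++ : ∀ {I Post} os os′ {cfg} → Along I os (Along I os′ Post) cfg → Along I (os ++ os′) Post cfg
  Along-++ [] os′ h = h
  Along-++ (o ∷ os) os′ (i , h) = i , Along-++ os os′ h

  Along-mono : ∀ {I} {Post Post′ : (Fin n → Local) → Set} os {cfg} → (∀ c → Post c → Post′ c) →
    Along I os Post cfg → Along I os Post′ cfg
  Along-mono [] f h = f _ h
  Along-mono (o ∷ os) f (i , h) = i , Along-mono os f h

-- Every vertex broadcasts all of its public data in every round.
module Broadcast (program : ℕ → ℕ → List Op) (out : ℕ → ℕ → Local → ℕ) (k : ℕ) where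

  record Node : Set where
    constructor node
    field
      size maxDegree degree : ℕ
      ops : List Op
      current : Local

  runStep : Node → (ℕ → Maybe ℕ) → Node
  runStep (node n Δ d [] s) f = node n Δ d [] s
  runStep (node n Δ d (o ∷ os) s) f = node n Δ d os (o s (collect (suc n ^ k) {{m^n≢0 (suc n) k}} d f))

  message : Node → ℕ
  message (node n Δ d os s) = encode (suc n ^ k) {{m^n≢0 (suc n) k}} s

  algorithm : Algorithm
  algorithm = record
    { State = Node
    ; init = λ n Δ ident d → node n Δ d (program n Δ) (local ident 0 0 0)
    ; send = λ s _ → just (message s)
    ; step = runStep
    ; rounds = λ n Δ → length (program n Δ)
    ; output = λ s → out (Node.size s) (Node.maxDegree s) (Node.current s)
    }

  module _ {n : ℕ} (G : Graph n) (Δ : ℕ) (ident : Fin n → ℕ) where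
    open Graph G using (nbrs; deg)
    open Execution G
    open Run algorithm G Δ ident

    Bounded : (Fin n → Local) → Set
    Bounded cfg = ∀ v → BoundedBy (suc n ^ k) (cfg v)

    private
      instance
        B≢0 : NonZero (suc n ^ k)
        B≢0 = m^n≢0 (suc n) k

    module _ {Post : (Fin n → Local) → Set}
             (valid : Along Bounded (program n Δ) Post (λ v → local (ident v) 0 0 0)) where

      -- Boundedness before each round serves twice: it limits the messages, and it makes decoding
      -- invert encoding, so that the vertices really receive the data of their neighbours.
      reached : ∀ t → t ≤ T → Σ (List Op) λ os → Σ (Fin n → Local) λ cfg →
        length os + t ≡ T × Along Bounded os Post cfg × (∀ v → state t v ≡ node n Δ (deg v) os (cfg v))
      reached zero _ = program n Δ , _ , +-identityʳ _ , valid , λ _ → refl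
      reached (suc t) t<T with reached t (<⇒≤ t<T)
      ... | [] , cfg , refl , _ , _ = ⊥-elim (<-irrefl refl t<T)
      ... | o ∷ os , cfg , len , (bounded , along) , same =
          os , apply o cfg , trans (+-suc (length os) t) len , along , next
        where
        next : ∀ v → state (suc t) v ≡ node n Δ (deg v) os (apply o cfg v)
        next v = trans (cong (λ s → runStep s (inbox (state t) v)) (same v))
          (cong (λ ms → node n Δ (deg v) os (o (cfg v) ms))
            (trans (collect-map _ (nbrs v) (λ u → just (message (state t u))) (λ u → encode (suc n ^ k) (cfg u))
                     (λ u → cong (just ∘ message) (same u)))
                   (map-cong′ (nbrs v))))
          where
          map-cong′ : ∀ us → map (decode (suc n ^ k) ∘ (λ u → encode (suc n ^ k) (cfg u))) us ≡ map cfg us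
          map-cong′ [] = refl
          map-cong′ (u ∷ us) = cong₂ _∷_ (decode-encode _ (cfg u) (bounded u)) (map-cong′ us)

      bandwidth : Bandwidth (k * 4)
      bandwidth t v j m t<T _ sent with reached t (<⇒≤ t<T)
      ... | [] , cfg , refl , _ , _ = ⊥-elim (<-irrefl refl t<T)
      ... | o ∷ os , cfg , len , (bounded , along) , same = begin-strict
          m ≡⟨ just-injective sent ⟨
          message (state t v) ≡⟨ cong message (same v) ⟩
          encode (suc n ^ k) (cfg v) <⟨ encode-< _ (cfg v) (bounded v) ⟩
          (suc n ^ k) ^ 4 ≡⟨ ^-*-assoc (suc n) k 4 ⟩
          suc n ^ (k * 4) ∎
        where open ≤-Reasoning

      outcome : Σ (Fin n → Local) λ cfg → Post cfg × (∀ v → colour v ≡ out n Δ (cfg v))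
      outcome with reached T ≤-refl
      ... | [] , cfg , _ , post , same = cfg , post , λ v → cong
          (λ s → out (Node.size s) (Node.maxDegree s) (Node.current s)) (same v)
      ... | o ∷ os , cfg , len , _ , _ = contradiction (trans (+-suc (length os) T) len) (m+1+n≢n (length os))

-- Iterated logarithms and Linial's colour reduction

n/2-bounds : ∀ n → ⌊ n /2⌋ + ⌊ n /2⌋ ≤ n × n ≤ suc (⌊ n /2⌋ + ⌊ n /2⌋)
n/2-bounds zero = z≤n , z≤n
n/2-bounds (suc zero) = z≤n , ≤-refl
n/2-bounds (suc (suc n)) with n/2-bounds n
... | l , u = ≤-trans (≤-reflexive (cong suc (+-suc ⌊ n /2⌋ ⌊ n /2⌋))) (s≤s (s≤s l))
            , ≤-trans (s≤s (s≤s u)) (≤-reflexive (cong (suc ∘ suc) (sym (+-suc ⌊ n /2⌋ ⌊ n /2⌋))))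

log₂-half : ∀ n → 2 ≤ n → ⌊log₂ n ⌋ ≡ suc ⌊log₂ ⌊ n /2⌋ ⌋
log₂-half n 2≤n = trans (sym (m+[n∸m]≡n (⌊log₂⌋-mono-≤ 2≤n))) (cong suc (sym (⌊log₂⌊n/2⌋⌋≡⌊log₂n⌋∸1 n)))

log₂-bounds : ∀ n → 1 ≤ n → 2 ^ ⌊log₂ n ⌋ ≤ n × n < 2 ^ suc ⌊log₂ n ⌋
log₂-bounds = <-rec _ go
  where
  go : ∀ n → (∀ {m} → m < n → 1 ≤ m → 2 ^ ⌊log₂ m ⌋ ≤ m × m < 2 ^ suc ⌊log₂ m ⌋) →
       1 ≤ n → 2 ^ ⌊log₂ n ⌋ ≤ n × n < 2 ^ suc ⌊log₂ n ⌋
  go n rec 1≤n with m≤n⇒m<n∨m≡n 1≤n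
  ... | inj₂ refl = ≤-refl , s≤s (s≤s z≤n)
  ... | inj₁ 2≤n with rec {⌊ n /2⌋} (half< 2≤n) (⌊n/2⌋-mono 2≤n) | n/2-bounds n
    where
    half< : ∀ {n} → 2 ≤ n → ⌊ n /2⌋ < n
    half< {suc m} _ = ⌊n/2⌋<n m
  ... | lo , hi | l , u = (begin
      2 ^ ⌊log₂ n ⌋ ≡⟨ cong (2 ^_) (log₂-half n 2≤n) ⟩
      2 ^ suc k ≡⟨ 2^[1+k]≡2^k+2^k k ⟩
      2 ^ k + 2 ^ k ≤⟨ +-mono-≤ lo lo ⟩
      h + h ≤⟨ l ⟩
      n ∎) , (begin-strict
      n ≤⟨ u ⟩
      suc (h + h) <⟨ s≤s (≤-reflexive (sym (+-suc h h))) ⟩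
      suc h + suc h ≤⟨ +-mono-≤ hi hi ⟩
      2 ^ suc k + 2 ^ suc k ≡⟨ 2^[1+k]≡2^k+2^k (suc k) ⟨
      2 ^ suc (suc k) ≡⟨ cong (λ t → 2 ^ suc t) (log₂-half n 2≤n) ⟨
      2 ^ suc ⌊log₂ n ⌋ ∎)
    where
    open ≤-Reasoning
    h = ⌊ n /2⌋
    k = ⌊log₂ h ⌋

2^log₂≤ : ∀ {n} → 1 ≤ n → 2 ^ ⌊log₂ n ⌋ ≤ n
2^log₂≤ {n} h = proj₁ (log₂-bounds n h)

<2^[1+log₂] : ∀ n → n < 2 ^ suc ⌊log₂ n ⌋
<2^[1+log₂] n with 1 ≤? n
... | yes 1≤n = proj₂ (log₂-bounds n 1≤n)
... | no 1≰n = ≤-trans (≰⇒> 1≰n) (m^n>0 2 (suc ⌊log₂ n ⌋))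

log₂-≤ : ∀ {n k} → n < 2 ^ suc k → ⌊log₂ n ⌋ ≤ k
log₂-≤ {n} {k} lt with 1 ≤? n
... | yes 1≤n = ≮⇒≥ (λ k< → <⇒≱ lt (≤-trans (^-monoʳ-≤ 2 k<) (2^log₂≤ 1≤n)))
... | no 1≰n = ≤-trans (⌊log₂⌋-mono-≤ {n} {0} (≤-pred (≰⇒> 1≰n))) z≤n

log₂-* : ∀ a b → ⌊log₂ (a * b) ⌋ ≤ suc (⌊log₂ a ⌋ + ⌊log₂ b ⌋)
log₂-* a b = log₂-≤ (begin-strict
  a * b <⟨ *-mono-< (<2^[1+log₂] a) (<2^[1+log₂] b) ⟩
  2 ^ suc ⌊log₂ a ⌋ * 2 ^ suc ⌊log₂ b ⌋ ≡⟨ ^-distribˡ-+-* 2 (suc ⌊log₂ a ⌋) (suc ⌊log₂ b ⌋) ⟨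
  2 ^ (suc ⌊log₂ a ⌋ + suc ⌊log₂ b ⌋) ≡⟨ cong (λ t → 2 ^ suc t) (+-suc ⌊log₂ a ⌋ ⌊log₂ b ⌋) ⟩
  2 ^ suc (suc (⌊log₂ a ⌋ + ⌊log₂ b ⌋)) ∎)
  where open ≤-Reasoning

log₂<n : ∀ {n} → 1 ≤ n → ⌊log₂ n ⌋ < n
log₂<n {n} h = <-≤-trans (n<2^n ⌊log₂ n ⌋) (2^log₂≤ h)

4*k≤2^k+4 : ∀ k → 4 * k ≤ 2 ^ k + 4
4*k≤2^k+4 0 = z≤n
4*k≤2^k+4 1 = m≤n+m 4 2
4*k≤2^k+4 2 = ≤-refl
4*k≤2^k+4 (suc k@(suc (suc j))) = begin
  4 * suc k ≡⟨ *-suc 4 k ⟩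
  4 + 4 * k ≤⟨ +-mono-≤ (^-monoʳ-≤ 2 (s≤s (s≤s (z≤n {j})))) (4*k≤2^k+4 k) ⟩
  2 ^ k + (2 ^ k + 4) ≡⟨ +-assoc (2 ^ k) (2 ^ k) 4 ⟨
  2 ^ k + 2 ^ k + 4 ≡⟨ cong (_+ 4) (2^[1+k]≡2^k+2^k k) ⟨
  2 ^ suc k + 4 ∎
  where open ≤-Reasoning

4*log₂≤n+4 : ∀ n → 4 * ⌊log₂ n ⌋ ≤ n + 4
4*log₂≤n+4 n with 1 ≤? n
... | yes 1≤n = ≤-trans (4*k≤2^k+4 ⌊log₂ n ⌋) (+-monoˡ-≤ 4 (2^log₂≤ 1≤n))
... | no 1≰n = ≤-trans (*-monoʳ-≤ 4 (⌊log₂⌋-mono-≤ {n} {0} (≤-pred (≰⇒> 1≰n)))) z≤n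

^-distribʳ-* : ∀ o m n → (m * n) ^ o ≡ m ^ o * n ^ o
^-distribʳ-* zero m n = refl
^-distribʳ-* (suc o) m n = trans (cong (m * n *_) (^-distribʳ-* o m n)) (ar m n (m ^ o) (n ^ o))
  where
  ar : ∀ m n p q → m * n * (p * q) ≡ m * p * (n * q)
  ar = solve-∀

-- Double counting: each neighbour spoils at most `k` of the `N` points. With `h = 0` the minimum is
-- a conflict-free point, as in Linial's step; with larger `h` it is a translate with few conflicts.
argmin-avoid : ∀ {A : Set} N (us : List A) (cost : A → ℕ → ℕ) k h →
  (∀ u → u ∈ us → sumBelow N (cost u) ≤ k) → length us * k < N * suc h →
  sumOver us (λ u → cost u (argmin N (λ x → sumOver us (λ u → cost u x)))) ≤ h
argmin-avoid N us cost k h each total = argmin-average N _ h (begin-strict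
  sumBelow N (λ x → sumOver us (λ u → cost u x)) ≡⟨ sumBelow-sumOver N us cost ⟩
  sumOver us (λ u → sumBelow N (cost u)) ≤⟨ sumOver≤ us k each ⟩
  length us * k <⟨ total ⟩
  N * suc h ∎)
  where open ≤-Reasoning

digits-unique : ∀ B .{{_ : NonZero B}} {a b r s} → r < B → s < B → a * B + r ≡ b * B + s → a ≡ b × r ≡ s
digits-unique B {a} {b} {r} {s} r< s< eq =
    trans (sym (digit-/ a B r<)) (trans (cong (λ t → t / B) eq) (digit-/ b B s<))
  , trans (sym (digit-% a B r<)) (trans (cong (λ t → t % B) eq) (digit-% b B s<))
  
module _ {Q : ℕ} (Q-prime : Prime Q) (d : ℕ) where
  linialCost : ℕ → Local → ℕ → ℕ
  linialCost a u x = indicator (hash Q-prime (suc d) (label u) x ≟ hash Q-prime (suc d) a x)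

  linialPoint : ℕ → List Local → ℕ
  linialPoint a us = argmin Q (λ x → sumOver us (λ u → linialCost a u x))

  linialOp : Op
  linialOp s us = local (linialPoint (label s) us * Q + hash Q-prime (suc d) (label s)
      (linialPoint (label s) us)) 0 0 0

module _ {n : ℕ} (G : Graph n) {Δ : ℕ} (deg≤ : ∀ v → Graph.deg G v ≤ Δ) where
  open Graph G using (nbrs; deg; Adj)
  open Execution G

  record Coloured (M : ℕ) (cfg : Fin n → Local) : Set where
    field
      proper : ∀ u v → Adj u v → label (cfg u) ≢ label (cfg v)
      below : ∀ v → label (cfg v) < M
      fresh : ∀ v → cfg v ≡ local (label (cfg v)) 0 0 0
  open Coloured

  Coloured-mono : ∀ {M M′ cfg} → M ≤ M′ → Coloured M cfg → Coloured M′ cfg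
  Coloured-mono le c = record { proper = proper c ; below = λ v → <-≤-trans (below c v) le ; fresh = fresh c }

  Coloured-bounded : ∀ {M B cfg} → M ≤ B → 1 ≤ B → Coloured M cfg → ∀ v → BoundedBy B (cfg v)
  Coloured-bounded {B = B} le 1≤B c v = subst (BoundedBy B) (sym (fresh c v))
      (<-≤-trans (below c v) le , 1≤B , 1≤B , 1≤B)

  length-inputs : ∀ (cfg : Fin n → Local) v → length (map cfg (nbrs v)) ≤ Δ
  length-inputs cfg v = ≤-trans (≤-reflexive (length-map cfg (nbrs v))) (deg≤ v)

  linial-step : ∀ {Q} (Q-prime : Prime Q) d {cfg} → d * Δ < Q → Coloured (Q ^ suc d) cfg →
    Coloured (Q * Q) (apply (linialOp Q-prime d) cfg)
  linial-step {Q} Q-prime d {cfg} dΔ<Q col = record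
    { proper = λ u v u∈ eq → let (x≡ , y≡) = digits-unique Q {{nz}} {point u} {point v} (value< u) (value< v) eq in
        indicator≡0⇒¬ (hash Q-prime (suc d) (label (cfg u)) (point v) ≟ value v) (free v u∈)
          (trans (cong (hash Q-prime (suc d) (label (cfg u))) (sym x≡)) y≡)
    ; below = λ v → digit-< (argmin< Q (λ x → sumOver (map cfg (nbrs v))
        (λ u → linialCost Q-prime d (label (cfg v)) u x)) 0<Q) (value< v)
    ; fresh = λ v → refl
    }
    where
    0<Q : 0 < Q
    0<Q = ≤-<-trans z≤n dΔ<Q
    nz : NonZero Q
    nz = >-nonZero 0<Q
    point : Fin n → ℕ
    point v = linialPoint Q-prime d (label (cfg v)) (map cfg (nbrs v))
    value : Fin n → ℕ
    value v = hash Q-prime (suc d) (label (cfg v)) (point v)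
    value< : ∀ v → value v < Q
    value< v = hash< Q-prime (suc d) (label (cfg v)) (point v)
    free : ∀ v {u} → Adj u v → linialCost Q-prime d (label (cfg v)) (cfg u) (point v) ≡ 0
    free v u∈ = sumOver≡0 (map cfg (nbrs v)) (n≤0⇒n≡0
      (argmin-avoid Q (map cfg (nbrs v)) (linialCost Q-prime d (label (cfg v))) d 0 each
        (≤-<-trans (*-monoˡ-≤ d (length-inputs cfg v)) (subst₂ _<_ (*-comm d Δ) (sym (*-identityʳ Q)) dΔ<Q))))
      (∈-map⁺ cfg u∈)
      where
      each : ∀ s → s ∈ map cfg (nbrs v) → sumBelow Q (linialCost Q-prime d (label (cfg v)) s) ≤ d
      each s s∈ with ∈-map⁻ cfg s∈
      ... | u , u∈ , refl = hash-agreement Q-prime d (proper col u v u∈) (below col u) (below col v)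

-- Colour reduction in exactly log* n rounds

module LinialProgram (c K D : ℕ) where
  -- X is large enough for a bound X + (2 + c) x on the number of bits of a colour to become
  -- X + (2 + c) log₂ x in one round.
  X linialBound : ℕ
  X = 4 * ⌊log₂ D ⌋ + (c + 42)
  linialBound = 64 * K * D

  -- Reading `E` bits with E + 1 digits is wasteful, but the round then depends on the bit bound
  -- alone: the prime is of order E · D, and its square has about 2 log E + 2 log D bits.
  crude : ℕ → Op
  crude E = linialOp (proj₁ (proj₂ (primeAbove (E * D)))) E

  final : Op
  final = linialOp (proj₁ (proj₂ (primeAbove (K * D)))) 3

  -- The 8 is 6 bits for the factor 64 in the prime bound and one for rounding each logarithm; the
  -- factor 2 is there because a new colour is a pair of residues.
  nextBits : ℕ → ℕ
  nextBits E = 2 * (8 + ⌊log₂ E ⌋ + ⌊log₂ D ⌋)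

  -- `x` runs through the iterated logarithms of n, and `E` bounds the bits of the current colours.
  -- The round that `logStar` counts with ⌊log₂ x⌋ ≤ 1 is the one given to `final`.
  reduction : ℕ → ℕ → ℕ → List Op
  reduction zero x E = []
  reduction (suc f) x E = if ⌊log₂ x ⌋ ≤ᵇ 1 then final ∷ [] else crude E ∷ reduction f ⌊log₂ x ⌋ (nextBits E)

  linialProgram : ℕ → List Op
  -- The slope 2 + c instead of `c` keeps the bit bound positive for c = 0, and `nextBits≤` needs a
  -- slope of at least 2.
  linialProgram n = if n ≤ᵇ 1 then [] else reduction n n ((2 + c) * suc ⌊log₂ n ⌋)

  ≤ᵇ-true : ∀ m n → (m ≤ᵇ n) ≡ true → m ≤ n
  ≤ᵇ-true m n eq = ≤ᵇ⇒≤ m n (subst Bool.T (sym eq) tt)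

  ≤ᵇ-false : ∀ m n → (m ≤ᵇ n) ≡ false → n < m
  ≤ᵇ-false m n eq = ≰⇒> (λ le → subst Bool.T eq (≤⇒≤ᵇ le))

  logStarFuel-≤1 : ∀ f {x} → (x ≤ᵇ 1) ≡ true → logStarFuel f x ≡ 0
  logStarFuel-≤1 zero eq = refl
  logStarFuel-≤1 (suc f) eq rewrite eq = refl

  length-reduction : ∀ f x E → (x ≤ᵇ 1) ≡ false → length (reduction f x E) ≡ logStarFuel f x
  length-reduction zero x E big = refl
  length-reduction (suc f) x E big rewrite big with ⌊log₂ x ⌋ ≤ᵇ 1 in eq
  ... | true = cong suc (sym (logStarFuel-≤1 f eq))
  ... | false = cong suc (length-reduction f ⌊log₂ x ⌋ (nextBits E) eq)

  length-linialProgram : ∀ n → length (linialProgram n) ≡ logStar n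
  length-linialProgram n with n ≤ᵇ 1 in eq
  ... | true = sym (logStarFuel-≤1 n eq)
  ... | false = length-reduction n n _ eq

  -- Since E ≤ (X + 2 + c) · x, the logarithms separate, and 4 log m ≤ m + 4 turns the constant part
  -- back into X + 2 + c + 4. Together with 36 + 4 log D from `nextBits` this is 2X, which is where
  -- c + 42 in `X` comes from.
  nextBits≤ : ∀ E x → 1 ≤ x → E ≤ X + (2 + c) * x → nextBits E ≤ X + (2 + c) * ⌊log₂ x ⌋
  nextBits≤ E x 1≤x E≤ = *-cancelˡ-≤ 2 (begin
      2 * (2 * (8 + ⌊log₂ E ⌋ + ⌊log₂ D ⌋)) ≤⟨ *-monoʳ-≤ 2 (*-monoʳ-≤ 2 (+-monoˡ-≤ ⌊log₂ D ⌋ (+-monoʳ-≤ 8 logE))) ⟩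
      2 * (2 * (8 + suc (⌊log₂ X + (2 + c) ⌋ + ⌊log₂ x ⌋) + ⌊log₂ D ⌋))
        ≡⟨ ar₁ ⌊log₂ X + (2 + c) ⌋ ⌊log₂ x ⌋ ⌊log₂ D ⌋ ⟩
      4 * ⌊log₂ X + (2 + c) ⌋ + (4 * ⌊log₂ x ⌋ + 36 + 4 * ⌊log₂ D ⌋)
        ≤⟨ +-monoˡ-≤ _ (4*log₂≤n+4 (X + (2 + c))) ⟩
      (X + (2 + c) + 4) + (4 * ⌊log₂ x ⌋ + 36 + 4 * ⌊log₂ D ⌋)
        ≤⟨ m≤m+n _ (2 * c * ⌊log₂ x ⌋) ⟩
      (X + (2 + c) + 4) + (4 * ⌊log₂ x ⌋ + 36 + 4 * ⌊log₂ D ⌋) + 2 * c * ⌊log₂ x ⌋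
        ≡⟨ ar₂ ⌊log₂ D ⌋ c ⌊log₂ x ⌋ ⟩
      2 * (X + (2 + c) * ⌊log₂ x ⌋) ∎)
    where
    open ≤-Reasoning
    ar₁ : ∀ p x d → 2 * (2 * (8 + suc (p + x) + d)) ≡ 4 * p + (4 * x + 36 + 4 * d)
    ar₁ = solve-∀
    ar₂ : ∀ d c x → (4 * d + (c + 42) + (2 + c) + 4) + (4 * x + 36 + 4 * d) + 2 * c * x ≡ 2 *
        (4 * d + (c + 42) + (2 + c) * x)
    ar₂ = solve-∀
    logE : ⌊log₂ E ⌋ ≤ suc (⌊log₂ X + (2 + c) ⌋ + ⌊log₂ x ⌋)
    logE = ≤-trans (⌊log₂⌋-mono-≤ (begin
      E ≤⟨ E≤ ⟩
      X + (2 + c) * x ≤⟨ +-monoˡ-≤ _ (m≤m*n X x {{>-nonZero 1≤x}}) ⟩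
      X * x + (2 + c) * x ≡⟨ *-distribʳ-+ x X (2 + c) ⟨
      (X + (2 + c)) * x ∎)) (log₂-* (X + (2 + c)) x)

  module _ {n : ℕ} (G : Graph n) {Δ : ℕ} (deg≤ : ∀ v → Graph.deg G v ≤ Δ) (1≤D : 1 ≤ D) (Δ≤D : Δ ≤ D)
           (K-large : 2 ^ (2 * c + 44) ≤ K) where
    open Execution G

    crude-step : ∀ {E cfg} → 1 ≤ E → Coloured G deg≤ (2 ^ E) cfg → Coloured G deg≤ (2 ^ nextBits E)
        (apply (crude E) cfg)
    crude-step {E} 1≤E col with primeAbove (E * D)
    ... | p , pr , ED<p , p≤ = Coloured-mono G deg≤ pp≤ (linial-step G deg≤ pr E
            (≤-<-trans (*-monoʳ-≤ E Δ≤D) ED<p)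
            (Coloured-mono G deg≤ (≤-trans (^-monoˡ-≤ E (prime>1 pr))
                (^-monoʳ-≤ p {{>-nonZero (<⇒≤ (prime>1 pr))}} (n≤1+n E))) col))
      where
      open ≤-Reasoning
      p≤2^ : p ≤ 2 ^ (8 + ⌊log₂ E ⌋ + ⌊log₂ D ⌋)
      p≤2^ = begin
        p ≤⟨ p≤ (*-mono-≤ 1≤E 1≤D) ⟩
        64 * (E * D) ≤⟨ *-monoʳ-≤ 64 (*-mono-≤ (<⇒≤ (<2^[1+log₂] E)) (<⇒≤ (<2^[1+log₂] D))) ⟩
        64 * ((2 * 2 ^ ⌊log₂ E ⌋) * (2 * 2 ^ ⌊log₂ D ⌋)) ≡⟨ ar (2 ^ ⌊log₂ E ⌋) (2 ^ ⌊log₂ D ⌋) ⟩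
        (2 ^ 8 * 2 ^ ⌊log₂ E ⌋) * 2 ^ ⌊log₂ D ⌋ ≡⟨ cong (_* 2 ^ ⌊log₂ D ⌋) (^-distribˡ-+-* 2 8 ⌊log₂ E ⌋) ⟨
        2 ^ (8 + ⌊log₂ E ⌋) * 2 ^ ⌊log₂ D ⌋ ≡⟨ ^-distribˡ-+-* 2 (8 + ⌊log₂ E ⌋) ⌊log₂ D ⌋ ⟨
        2 ^ (8 + ⌊log₂ E ⌋ + ⌊log₂ D ⌋) ∎
        where
        ar : ∀ a b → 64 * ((2 * a) * (2 * b)) ≡ (256 * a) * b
        ar = solve-∀
      pp≤ : p * p ≤ 2 ^ nextBits E
      pp≤ = begin
        p * p ≤⟨ *-mono-≤ p≤2^ p≤2^ ⟩
        2 ^ t * 2 ^ t ≡⟨ ^-distribˡ-+-* 2 t t ⟨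
        2 ^ (t + t) ≡⟨ cong (2 ^_) (cong (t +_) (+-identityʳ t)) ⟨
        2 ^ nextBits E ∎
        where t = 8 + ⌊log₂ E ⌋ + ⌊log₂ D ⌋

    4≤K : 4 ≤ K
    4≤K = ≤-trans (^-monoʳ-≤ 2 {2} {2 * c + 44} (≤-trans (s≤s (s≤s z≤n)) (m≤n+m 44 (2 * c)))) K-large

    -- At ⌊log₂ x⌋ ≤ 1 the bit bound has become 4 log D + (2c + 44). Hence there are at most D⁴ · K
    -- colours, and four digits to a base above K · D hold them; this fixes the size required of
    -- `K`.
    final-step : ∀ {E cfg} → E ≤ X + (2 + c) → Coloured G deg≤ (2 ^ E) cfg → Coloured G deg≤
        (linialBound * linialBound) (apply final cfg)
    final-step {E} E≤ col with primeAbove (K * D)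
    ... | p , pr , KD<p , p≤ = Coloured-mono G deg≤ (*-mono-≤ p≤′ p≤′) (linial-step G deg≤ pr 3
            (≤-<-trans (*-mono-≤ (<⇒≤ 4≤K) Δ≤D) KD<p) (Coloured-mono G deg≤ fits col))
      where
      open ≤-Reasoning
      p≤′ : p ≤ linialBound
      p≤′ = ≤-trans (p≤ (*-mono-≤ (<⇒≤ (≤-trans (s≤s (s≤s z≤n)) 4≤K)) 1≤D)) (≤-reflexive (sym (*-assoc 64 K D)))
      ar : ∀ d c → 4 * d + (c + 42) + (2 + c) ≡ d * 4 + (2 * c + 44)
      ar = solve-∀
      fits : 2 ^ E ≤ p ^ 4
      fits = begin
        2 ^ E ≤⟨ ^-monoʳ-≤ 2 E≤ ⟩
        2 ^ (X + (2 + c)) ≡⟨ cong (2 ^_) (ar ⌊log₂ D ⌋ c) ⟩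
        2 ^ (⌊log₂ D ⌋ * 4 + (2 * c + 44)) ≡⟨ ^-distribˡ-+-* 2 (⌊log₂ D ⌋ * 4) (2 * c + 44) ⟩
        2 ^ (⌊log₂ D ⌋ * 4) * 2 ^ (2 * c + 44) ≡⟨ cong (_* 2 ^ (2 * c + 44)) (^-*-assoc 2 ⌊log₂ D ⌋ 4) ⟨
        (2 ^ ⌊log₂ D ⌋) ^ 4 * 2 ^ (2 * c + 44) ≤⟨ *-mono-≤ (^-monoˡ-≤ 4 (2^log₂≤ 1≤D)) K-large ⟩
        D ^ 4 * K ≤⟨ *-monoʳ-≤ (D ^ 4) (m≤m*n K (K ^ 3)
            {{m^n≢0 K 3 {{>-nonZero (<⇒≤ (≤-trans (s≤s (s≤s z≤n)) 4≤K))}}}}) ⟩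
        D ^ 4 * K ^ 4 ≡⟨ *-comm (D ^ 4) (K ^ 4) ⟩
        K ^ 4 * D ^ 4 ≡⟨ ^-distribʳ-* 4 K D ⟨
        (K * D) ^ 4 ≤⟨ ^-monoˡ-≤ 4 (<⇒≤ KD<p) ⟩
        p ^ 4 ∎

    reduction-correct : ∀ B L → 2 ^ (X + (2 + c) * L) ≤ B → ∀ f x E {cfg} → 2 ≤ x → x ≤ f → ⌊log₂ x ⌋ ≤ L →
      1 ≤ E → E ≤ X + (2 + c) * ⌊log₂ x ⌋ → Coloured G deg≤ (2 ^ E) cfg →
      Along (λ c → ∀ v → BoundedBy B (c v)) (reduction f x E) (Coloured G deg≤ (linialBound * linialBound)) cfg
    reduction-correct B L room zero x E 2≤x x≤f _ _ _ _ = contradiction (≤-trans 2≤x x≤f) λ ()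
    reduction-correct B L room (suc f) x E 2≤x x≤f x≤L 1≤E E≤ col with ⌊log₂ x ⌋ ≤ᵇ 1 in eq
    ... | true = bounded , final-step (≤-trans E≤ (≤-trans
        (+-monoʳ-≤ X (*-monoʳ-≤ (2 + c) (≤ᵇ-true ⌊log₂ x ⌋ 1 eq)))
        (≤-reflexive (cong (X +_) (*-identityʳ (2 + c)))))) col
      where
      bounded = Coloured-bounded G deg≤ (≤-trans (^-monoʳ-≤ 2
          (≤-trans E≤ (+-monoʳ-≤ X (*-monoʳ-≤ (2 + c) x≤L)))) room)
                  (≤-trans (m^n>0 2 (X + (2 + c) * L)) room) col
    ... | false = bounded , reduction-correct B L room f ⌊log₂ x ⌋ (nextBits E) (≤ᵇ-false ⌊log₂ x ⌋ 1 eq)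
            (≤-pred (≤-trans (log₂<n (<⇒≤ 2≤x)) x≤f)) (≤-trans (⌊log₂⌋-mono-≤ (<⇒≤ (log₂<n (<⇒≤ 2≤x)))) x≤L)
            (s≤s z≤n) (nextBits≤ E ⌊log₂ x ⌋ (<⇒≤ (≤ᵇ-false ⌊log₂ x ⌋ 1 eq)) E≤) (crude-step 1≤E col)
      where
      bounded = Coloured-bounded G deg≤ (≤-trans (^-monoʳ-≤ 2
          (≤-trans E≤ (+-monoʳ-≤ X (*-monoʳ-≤ (2 + c) x≤L)))) room)
                  (≤-trans (m^n>0 2 (X + (2 + c) * L)) room) col

    linialProgram-correct : ∀ B {cfg} → 2 ^ (X + (2 + c) * ⌊log₂ n ⌋) ≤ B → Coloured G deg≤ (suc n ^ c) cfg →
      Along (λ c → ∀ v → BoundedBy B (c v)) (linialProgram n) (Coloured G deg≤ (linialBound * linialBound)) cfg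
    linialProgram-correct B room col with n ≤ᵇ 1 in eq
    ... | true = Coloured-mono G deg≤ (begin
        suc n ^ c ≤⟨ ^-monoˡ-≤ c (s≤s (≤ᵇ-true n 1 eq)) ⟩
        2 ^ c ≤⟨ ^-monoʳ-≤ 2 (≤-trans (m≤n*m c 2) (m≤m+n (2 * c) 44)) ⟩
        2 ^ (2 * c + 44) ≤⟨ K-large ⟩
        K ≤⟨ m≤m*n K D {{>-nonZero 1≤D}} ⟩
        K * D ≤⟨ *-monoˡ-≤ D (m≤n*m K 64) ⟩
        linialBound ≤⟨ m≤m*n linialBound linialBound
            {{>-nonZero (*-mono-≤ {1} {64 * K} (*-mono-≤ {1} {64} (s≤s z≤n)
            (<⇒≤ (≤-trans (s≤s (s≤s z≤n)) 4≤K))) 1≤D)}} ⟩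
        linialBound * linialBound ∎) col
      where open ≤-Reasoning
    ... | false = reduction-correct B ⌊log₂ n ⌋ room n n _ (≤ᵇ-false n 1 eq) ≤-refl ≤-refl
        (*-mono-≤ {1} {2 + c} (s≤s z≤n) (s≤s z≤n)) E≤
        (Coloured-mono G deg≤ (begin
          suc n ^ c ≤⟨ ^-monoʳ-≤ (suc n) (m≤n+m c 2) ⟩
          suc n ^ (2 + c) ≤⟨ ^-monoˡ-≤ (2 + c) (<2^[1+log₂] n) ⟩
          (2 ^ suc ⌊log₂ n ⌋) ^ (2 + c) ≡⟨ ^-*-assoc 2 (suc ⌊log₂ n ⌋) (2 + c) ⟩
          2 ^ (suc ⌊log₂ n ⌋ * (2 + c)) ≡⟨ cong (2 ^_) (*-comm (suc ⌊log₂ n ⌋) (2 + c)) ⟩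
          2 ^ ((2 + c) * suc ⌊log₂ n ⌋) ∎) col)
      where
      open ≤-Reasoning
      E≤ : (2 + c) * suc ⌊log₂ n ⌋ ≤ X + (2 + c) * ⌊log₂ n ⌋
      E≤ = begin
        (2 + c) * suc ⌊log₂ n ⌋ ≡⟨ *-suc (2 + c) ⌊log₂ n ⌋ ⟩
        (2 + c) + (2 + c) * ⌊log₂ n ⌋ ≤⟨ +-monoˡ-≤ _
            (≤-trans (≤-trans (≤-reflexive (+-comm 2 c)) (+-monoʳ-≤ c (m≤n+m 2 40)))
            (m≤n+m (c + 42) (4 * ⌊log₂ D ⌋))) ⟩
        X + (2 + c) * ⌊log₂ n ⌋ ∎

-- Partition into classes of small out-degree

module Trials {P : ℕ} (P-prime : Prime P) (d β : ℕ) where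

  -- The leading digit makes the polynomial non-constant.
  value : ℕ → ℕ → ℕ
  value a x = hash P-prime (2 + d) (P ^ suc d + a) x

  class : Local → ℕ
  class s = value (label s) (pred (trial s))

  class< : ∀ s → class s < P
  class< s = hash< P-prime (2 + d) (P ^ suc d + label s) (pred (trial s))

  -- A settled neighbour takes part with the value from the trial in which it settled, an unsettled
  -- one with the value it is trying now.
  pointAt : ℕ → ℕ → ℕ
  pointAt zero x = x
  pointAt (suc t) x = t

  trialCost : ℕ → Local → Local → ℕ
  trialCost x s u = indicator (value (label u) (pointAt (trial u) x) ≟ value (label s) x)

  newTrial : ℕ → Local → List Local → ℕ
  newTrial x s us with trial s
  ... | suc t = suc t
  ... | zero with sumOver us (trialCost x s) ≤? β
  ...   | yes _ = suc x
  ...   | no _ = zero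

  trialOp : ℕ → Op
  trialOp x s us = local (label s) (newTrial x s us) (shift s) (place s)

  trialProgram : ℕ → ℕ → List Op
  trialProgram zero x = []
  trialProgram (suc k) x = trialOp x ∷ trialProgram k (suc x)

  length-trialProgram : ∀ k x → length (trialProgram k x) ≡ k
  length-trialProgram zero x = refl
  length-trialProgram (suc k) x = cong suc (length-trialProgram k (suc x))

  data TrialStep (x : ℕ) (s : Local) (us : List Local) : ℕ → Set where
    kept   : ∀ t → trial s ≡ suc t → TrialStep x s us (suc t)
    joined : trial s ≡ 0 → sumOver us (trialCost x s) ≤ β → TrialStep x s us (suc x)
    failed : trial s ≡ 0 → β < sumOver us (trialCost x s) → TrialStep x s us 0

  trialStep : ∀ x s us → TrialStep x s us (newTrial x s us)
  trialStep x s us with trial s in eq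
  ... | suc t = kept t eq
  ... | zero with sumOver us (trialCost x s) ≤? β
  ...   | yes le = joined eq le
  ...   | no ≰ = failed eq (≰⇒> ≰)

  -- Two vertices of one class that settled in the same trial are out-neighbours of each other. The
  -- trial test counts such ties, so the bound β covers them.
  OutNeighbour : Local → Local → Set
  OutNeighbour s u = 1 ≤ trial u × trial u ≤ trial s × class u ≡ class s

  outNeighbour? : ∀ s u → Dec (OutNeighbour s u)
  outNeighbour? s u = (1 ≤? trial u) ×-dec (trial u ≤? trial s) ×-dec (class u ≟ class s)

  hit? : ∀ s u x → Dec (1 ≤ trial u × class u ≡ value (label s) x)
  hit? s u x = (1 ≤? trial u) ×-dec (class u ≟ value (label s) x)

  meet? : ∀ s u x → Dec (value (label u) x ≡ value (label s) x)
  meet? s u x = value (label u) x ≟ value (label s) x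

  -- Counts the conflicts of s with u before trial x as if u had been both active and settled
  -- in all of them: an upper bound that does not depend on when u settled.
  spent : ℕ → Local → Local → ℕ
  spent x s u = sumBelow x (λ y → indicator (meet? s u y)) + sumBelow x (λ y → indicator (hit? s u y))

  module _ {n : ℕ} (G : Graph n) {Δ : ℕ} (deg≤ : ∀ v → Graph.deg G v ≤ Δ) {M : ℕ} (M≤ : M ≤ P ^ suc d)
           (enough : Δ * (suc d + suc d) < P * suc β) where
    open Graph G using (nbrs; deg; Adj)
    open Execution G

    -- `history` is the potential of the averaging argument: an unsettled vertex has failed in all
    -- `x` trials, each time with at least β + 1 conflicts. At x = P this exceeds the total that
    -- `spent≤` allows its neighbours.
    record Trying (x : ℕ) (cfg : Fin n → Local) : Set where
      field
        proper   : ∀ u v → Adj u v → label (cfg u) ≢ label (cfg v)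
        below    : ∀ v → label (cfg v) < M
        unplaced : ∀ v → shift (cfg v) ≡ 0 × place (cfg v) ≡ 0
        early    : ∀ v → trial (cfg v) ≤ x
        defect   : ∀ v → 1 ≤ trial (cfg v) → sumOver (nbrs v) (λ u → indicator (outNeighbour? (cfg v) (cfg u))) ≤ β
        history  : ∀ v → trial (cfg v) ≡ 0 → x * suc β ≤ sumOver (nbrs v) (λ u → spent x (cfg v) (cfg u))
    open Trying

    trying-start : ∀ {cfg} → Coloured G deg≤ M cfg → Trying 0 cfg
    trying-start {cfg} col = record
      { proper = Coloured.proper col
      ; below = Coloured.below col
      ; unplaced = λ v → cong shift (Coloured.fresh col v) , cong place (Coloured.fresh col v)
      ; early = λ v → ≤-reflexive (cong trial (Coloured.fresh col v))
      ; defect = λ v 1≤ → contradiction 1≤ (subst (λ t → 1 ≰ t) (sym (cong trial (Coloured.fresh col v))) λ ())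
      ; history = λ v _ → z≤n
      }

    module _ (x : ℕ) (cfg : Fin n → Local) (trying : Trying x cfg) where
      private
        cfg′ : Fin n → Local
        cfg′ = apply (trialOp x) cfg

        view : ∀ v → TrialStep x (cfg v) (map cfg (nbrs v)) (trial (cfg′ v))
        view v = trialStep x (cfg v) (map cfg (nbrs v))

      early′ : ∀ v → trial (cfg′ v) ≤ suc x
      early′ v with trial (cfg′ v) | view v
      ... | _ | kept t eq = ≤-trans (≤-reflexive (sym eq)) (m≤n⇒m≤1+n (early trying v))
      ... | _ | joined _ _ = ≤-refl
      ... | _ | failed _ _ = z≤n

      -- Whoever joins now gets a trial number above all earlier ones, so the out-neighbourhood of a
      -- settled vertex never grows.
      old-out : ∀ {t} u v → trial (cfg v) ≡ suc t → trial (cfg′ v) ≡ suc t → OutNeighbour (cfg′ v) (cfg′ u)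
          → OutNeighbour (cfg v) (cfg u)
      old-out {t} u v old new out with trial (cfg′ u) | view u | trial (cfg′ v) | new
      ... | _ | kept s eq | _ | refl rewrite eq | old = out
      ... | _ | joined eq _ | _ | refl = contradiction
          (≤-trans (proj₁ (proj₂ out)) (≤-trans (≤-reflexive (sym old)) (early trying v))) 1+n≰n
      ... | _ | failed eq _ | _ | refl = contradiction (proj₁ out) λ ()

      -- The test of a joining vertex has already charged every possible out-neighbour: those
      -- settled earlier in this class and those trying the same value, even if they fail.
      new-out : ∀ u v → trial (cfg′ v) ≡ suc x → OutNeighbour (cfg′ v) (cfg′ u) →
        value (label (cfg u)) (pointAt (trial (cfg u)) x) ≡ value (label (cfg v)) x
      new-out u v new out with trial (cfg′ u) | view u | trial (cfg′ v) | new
      ... | _ | kept s eq | _ | refl rewrite eq = proj₂ (proj₂ out)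
      ... | _ | joined eq _ | _ | refl rewrite eq = proj₂ (proj₂ out)
      ... | _ | failed eq _ | _ | refl = contradiction (proj₁ out) λ ()

      defect′ : ∀ v → 1 ≤ trial (cfg′ v) → sumOver (nbrs v) (λ u → indicator (outNeighbour? (cfg′ v) (cfg′ u))) ≤ β
      defect′ v 1≤ = go (trial (cfg′ v)) refl (view v)
        where
        go : ∀ t → trial (cfg′ v) ≡ t → TrialStep x (cfg v) (map cfg (nbrs v)) t →
          sumOver (nbrs v) (λ u → indicator (outNeighbour? (cfg′ v) (cfg′ u))) ≤ β
        go _ new (kept t old) = ≤-trans
          (sumOver-mono (nbrs v) (λ u _ → indicator-mono (outNeighbour? (cfg′ v) (cfg′ u))
              (outNeighbour? (cfg v) (cfg u)) (old-out u v old new)))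
          (defect trying v (subst (1 ≤_) (sym old) (s≤s z≤n)))
        go _ new (joined old cheap) = ≤-trans
          (sumOver-mono (nbrs v) (λ u _ → indicator-mono (outNeighbour? (cfg′ v) (cfg′ u)) (_ ≟ _)
              (new-out u v new)))
          (≤-trans (≤-reflexive (sym (sumOver-map (nbrs v) cfg (trialCost x (cfg v))))) cheap)
        go _ new (failed _ _) = contradiction (subst (1 ≤_) new 1≤) λ ()

      -- A conflict in trial `x` is a meeting of the two polynomials if `u` is unsettled and a hit
      -- on its class otherwise. Since a class never changes once chosen, the hits counted before
      -- `x` persist.
      spent-grows : ∀ u v → spent x (cfg v) (cfg u) + trialCost x (cfg v) (cfg u) ≤ spent (suc x) (cfg′ v) (cfg′ u)
      spent-grows u v = ≤-trans (≤-reflexive (+-assoc meets hits _)) (≤-trans (+-monoʳ-≤ meets tail)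
          (≤-reflexive (ar meets (indicator (meet? (cfg v) (cfg u) x))
              (sumBelow x (λ y → indicator (hit? (cfg′ v) (cfg′ u) y))) _)))
        where
        meets = sumBelow x (λ y → indicator (meet? (cfg v) (cfg u) y))
        hits = sumBelow x (λ y → indicator (hit? (cfg v) (cfg u) y))
        ar : ∀ m i h j → m + (h + (i + j)) ≡ m + i + (h + j)
        ar = solve-∀
        hits≤ : hits ≤ sumBelow x (λ y → indicator (hit? (cfg′ v) (cfg′ u) y))
        hits≤ = sumBelow-mono x (λ y _ → indicator-mono (hit? (cfg v) (cfg u) y) (hit? (cfg′ v) (cfg′ u) y) keep)
          where
          keep : ∀ {w} → 1 ≤ trial (cfg u) × class (cfg u) ≡ w → 1 ≤ trial (cfg′ u) × class (cfg′ u) ≡ w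
          keep (1≤ , eq) with trial (cfg′ u) | view u
          ... | _ | kept t old rewrite old = 1≤ , eq
          ... | _ | joined old _ = contradiction (subst (1 ≤_) old 1≤) λ ()
          ... | _ | failed old _ = contradiction (subst (1 ≤_) old 1≤) λ ()
        cost≤ : trialCost x (cfg v) (cfg u) ≤ indicator (meet? (cfg v) (cfg u) x) + indicator
            (hit? (cfg′ v) (cfg′ u) x)
        cost≤ = go (trial (cfg u)) refl
          where
          go : ∀ t → trial (cfg u) ≡ t → indicator (value (label (cfg u)) (pointAt t x) ≟ value (label (cfg v)) x)
                 ≤ indicator (meet? (cfg v) (cfg u) x) + indicator (hit? (cfg′ v) (cfg′ u) x)
          go zero _ = m≤m+n _ _
          go (suc t) old = ≤-trans (indicator-mono (_ ≟ _) (hit? (cfg′ v) (cfg′ u) x) hit) (m≤n+m _ _)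
            where
            hit : value (label (cfg u)) t ≡ value (label (cfg v)) x → 1 ≤ trial (cfg′ u) × class
                (cfg′ u) ≡ value (label (cfg v)) x
            hit eq with trial (cfg′ u) | view u
            ... | _ | kept t′ old′ with trans (sym old) old′
            ...   | refl = s≤s z≤n , eq
            hit eq | _ | joined old′ _ = contradiction (trans (sym old) old′) λ ()
            hit eq | _ | failed old′ _ = contradiction (trans (sym old) old′) λ ()
        tail : hits + trialCost x (cfg v) (cfg u) ≤
               sumBelow x (λ y → indicator (hit? (cfg′ v) (cfg′ u) y)) +
                   (indicator (meet? (cfg v) (cfg u) x) + indicator (hit? (cfg′ v) (cfg′ u) x))
        tail = +-mono-≤ hits≤ cost≤

      history′ : ∀ v → trial (cfg′ v) ≡ 0 → suc x * suc β ≤ sumOver (nbrs v) (λ u → spent (suc x) (cfg′ v) (cfg′ u))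
      history′ v new = go (trial (cfg′ v)) new (view v)
        where
        open ≤-Reasoning
        go : ∀ t → t ≡ 0 → TrialStep x (cfg v) (map cfg (nbrs v)) t → suc x * suc β ≤ sumOver (nbrs v)
            (λ u → spent (suc x) (cfg′ v) (cfg′ u))
        go _ _ (failed old dear) = begin
          suc β + x * suc β ≡⟨ +-comm (suc β) (x * suc β) ⟩
          x * suc β + suc β ≤⟨ +-mono-≤ (history trying v old)
              (≤-trans dear (≤-reflexive (sumOver-map (nbrs v) cfg (trialCost x (cfg v))))) ⟩
          sumOver (nbrs v) (λ u → spent x (cfg v) (cfg u)) + sumOver (nbrs v) (λ u → trialCost x (cfg v) (cfg u))
            ≡⟨ sumOver-+ (nbrs v) (λ u → spent x (cfg v) (cfg u)) (λ u → trialCost x (cfg v) (cfg u)) ⟨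
          sumOver (nbrs v) (λ u → spent x (cfg v) (cfg u) + trialCost x (cfg v) (cfg u))
            ≤⟨ sumOver-mono (nbrs v) (λ u _ → spent-grows u v) ⟩
          sumOver (nbrs v) (λ u → spent (suc x) (cfg′ v) (cfg′ u)) ∎

      trying-step : Trying (suc x) cfg′
      trying-step = record
        { proper = proper trying ; below = below trying ; unplaced = unplaced trying
        ; early = early′ ; defect = defect′ ; history = history′ }

    trialProgram-correct : ∀ B → M ≤ B → P < B → ∀ k x {cfg} → x + k ≤ P → Trying x cfg →
      Along (λ c → ∀ v → BoundedBy B (c v)) (trialProgram k x) (Trying (x + k)) cfg
    trialProgram-correct B M≤B P<B zero x le tr = subst (λ y → Trying y _) (sym (+-identityʳ x)) tr
    trialProgram-correct B M≤B P<B (suc k) x le tr =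
        (λ v → <-≤-trans (below tr v) M≤B
             , ≤-<-trans (≤-trans (early tr v) (m+n≤o⇒m≤o x le)) P<B
             , ≤-<-trans (≤-reflexive (proj₁ (unplaced tr v))) 0<B
             , ≤-<-trans (≤-reflexive (proj₂ (unplaced tr v))) 0<B)
      , Along-mono (trialProgram k (suc x)) (λ c → subst (λ y → Trying y c) (sym (+-suc x k)))
          (trialProgram-correct B M≤B P<B k (suc x) (≤-trans (≤-reflexive (sym (+-suc x k))) le)
              (trying-step x _ tr))
      where
      0<B : 0 < B
      0<B = ≤-<-trans z≤n P<B

    private
      1<P : 1 < P
      1<P = prime>1 P-prime

      instance
        P≢0 : NonZero P
        P≢0 = >-nonZero (<⇒≤ 1<P)

    leading< : ∀ {a} → a < M → P ^ suc d + a < P ^ (2 + d)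
    leading< {a} a<M = begin-strict
      P ^ suc d + a <⟨ +-monoʳ-< (P ^ suc d) (<-≤-trans a<M M≤) ⟩
      P ^ suc d + P ^ suc d ≡⟨ cong (P ^ suc d +_) (+-identityʳ (P ^ suc d)) ⟨
      2 * P ^ suc d ≤⟨ *-monoˡ-≤ (P ^ suc d) 1<P ⟩
      P ^ (2 + d) ∎
      where open ≤-Reasoning

    -- Both summands count agreements of distinct polynomials of degree at most d + 1. For the hits
    -- the second one is the constant class of `u`, which differs from the polynomial of `s` thanks
    -- to the leading digit.
    spent≤ : ∀ {s u} → label u ≢ label s → label s < M → label u < M → spent P s u ≤ suc d + suc d
    spent≤ {s} {u} u≢s s< u< = +-mono-≤
      (hash-agreement P-prime (suc d) (λ eq → u≢s (+-cancelˡ-≡ (P ^ suc d) _ _ eq)) (leading< u<) (leading< s<))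
      (≤-trans (sumBelow-mono P (λ y y< → indicator-mono (hit? s u y)
          (hash P-prime (2 + d) (class u) y ≟ value (label s) y)
                 (λ (_ , eq) → trans (hash-const P-prime (suc d) y (class< u)) eq)))
               (hash-agreement P-prime (suc d) (<⇒≢
                   (<-≤-trans (class< u) (≤-trans P≤ (m≤m+n (P ^ suc d) (label s)))))
                 (<-≤-trans (class< u) (≤-trans P≤ (^-monoʳ-≤ P (n≤1+n (suc d))))) (leading< s<)))
      where
      P≤ : P ≤ P ^ suc d
      P≤ = ≤-trans (≤-reflexive (sym (*-identityʳ P))) (^-monoʳ-≤ P (s≤s (z≤n {d})))

    record Partitioned (cfg : Fin n → Local) : Set where
      field
        proper   : ∀ u v → Adj u v → label (cfg u) ≢ label (cfg v)
        below    : ∀ v → label (cfg v) < M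
        unplaced : ∀ v → shift (cfg v) ≡ 0 × place (cfg v) ≡ 0
        early    : ∀ v → trial (cfg v) ≤ P
        classed  : ∀ v → 1 ≤ trial (cfg v)
        defect   : ∀ v → sumOver (nbrs v) (λ u → indicator (outNeighbour? (cfg v) (cfg u))) ≤ β

    trying-end : ∀ cfg → Trying P cfg → Partitioned cfg
    trying-end cfg tr = record
      { proper = proper tr ; below = below tr ; unplaced = unplaced tr ; early = early tr
      ; classed = joined′ ; defect = λ v → defect tr v (joined′ v) }
      where
      open ≤-Reasoning
      joined′ : ∀ v → 1 ≤ trial (cfg v)
      joined′ v = n≢0⇒n>0 (λ eq → <⇒≱ enough (begin
        P * suc β ≤⟨ history tr v eq ⟩
        sumOver (nbrs v) (λ u → spent P (cfg v) (cfg u))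
          ≤⟨ sumOver≤ (nbrs v) (suc d + suc d) (λ u u∈ → spent≤ {cfg v} {cfg u} (proper tr u v u∈) (below tr v)
              (below tr u)) ⟩
        deg v * (suc d + suc d) ≤⟨ *-monoˡ-≤ (suc d + suc d) (deg≤ v) ⟩
        Δ * (suc d + suc d) ∎))

-- Colouring class by class

module Placement {P : ℕ} (P-prime : Prime P) (d β : ℕ) {Q : ℕ} (Q-prime : Prime Q) (e h : ℕ) where
  open Trials P-prime d β

  shifted : ℕ → ℕ → ℕ → ℕ
  shifted a σ x = hash Q-prime (2 + e) (a * Q + σ) x

  poly : Local → ℕ → ℕ
  poly s x = shifted (label s) (shift s) x

  poly< : ∀ s x → poly s x < Q
  poly< s x = hash< Q-prime (2 + e) (label s * Q + shift s) x

  -- A final colour is a point of the plane over ℤ/Q; a coloured neighbour blocks `f` when its point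
  -- lies on the graph of `f`. The translates of one polynomial have disjoint graphs.
  Blocking : Local → (ℕ → ℕ) → Set
  Blocking u f = 1 ≤ place u × poly u (pred (place u)) ≡ f (pred (place u))

  blocking? : ∀ u f → Dec (Blocking u f)
  blocking? u f = (1 ≤? place u) ×-dec (poly u (pred (place u)) ≟ f (pred (place u)))

  shiftCost : ℕ → Local → ℕ → ℕ
  shiftCost a u σ = indicator (blocking? u (shifted a σ))

  newShift : ℕ → Local → List Local → ℕ
  newShift c s us with class s ≟ c
  ... | yes _ = argmin Q (λ σ → sumOver us (λ u → shiftCost (label s) u σ))
  ... | no _ = shift s

  shiftOp : ℕ → Op
  shiftOp c s us = local (label s) (trial s) (newShift c s us) (place s)

  blocked? : ∀ s u x → Dec (place u ≡ suc x × poly u x ≡ poly s x)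
  blocked? s u x = (place u ≟ suc x) ×-dec (poly u x ≟ poly s x)

  -- Out-neighbours choose their points in the same round, so every agreement with them has to be
  -- avoided and not only the one at the point they end up with.
  clash? : ∀ s u x → Dec (OutNeighbour s u × poly u x ≡ poly s x)
  clash? s u x = outNeighbour? s u ×-dec (poly u x ≟ poly s x)

  placeCost : Local → Local → ℕ → ℕ
  placeCost s u x = indicator (blocked? s u x) + indicator (clash? s u x)

  placeCosts : Local → List Local → ℕ → ℕ
  placeCosts s us x = sumOver us (λ u → placeCost s u x)

  newPlace : ℕ → Local → List Local → ℕ
  newPlace c s us with class s ≟ c
  ... | yes _ = suc (argmin Q (placeCosts s us))
  ... | no _ = place s

  placeOp : ℕ → Op
  placeOp c s us = local (label s) (trial s) (shift s) (newPlace c s us)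

  -- Each class takes two rounds: the translates must be fixed and broadcast before points can be
  -- compared.
  placeProgram : ℕ → ℕ → List Op
  placeProgram zero c = []
  placeProgram (suc k) c = shiftOp c ∷ placeOp c ∷ placeProgram k (suc c)

  length-placeProgram : ∀ k c → length (placeProgram k c) ≡ k + k
  length-placeProgram zero c = refl
  length-placeProgram (suc k) c = cong suc (trans (cong suc (length-placeProgram k (suc c))) (sym (+-suc k k)))

  finalColour : Local → ℕ
  finalColour s = pred (place s) * Q + poly s (pred (place s))

  module _ {n : ℕ} (G : Graph n) {Δ : ℕ} (deg≤ : ∀ v → Graph.deg G v ≤ Δ) {M : ℕ} (M≤P : M ≤ P ^ suc d)
           (enoughTrials : Δ * (suc d + suc d) < P * suc β)
           (M≤Q : M ≤ Q ^ suc e) (enoughShifts : Δ < Q * suc h) (enoughPlaces : h + β * suc e < Q) where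
    open Graph G using (nbrs; deg; Adj)
    open Execution G

    private
      0<Q : 0 < Q
      0<Q = ≤-<-trans z≤n enoughPlaces

    record Placing (c : ℕ) (cfg : Fin n → Local) : Set where
      field
        proper  : ∀ u v → Adj u v → label (cfg u) ≢ label (cfg v)
        below   : ∀ v → label (cfg v) < M
        early   : ∀ v → trial (cfg v) ≤ P
        classed : ∀ v → 1 ≤ trial (cfg v)
        defect  : ∀ v → sumOver (nbrs v) (λ u → indicator (outNeighbour? (cfg v) (cfg u))) ≤ β
        shift<  : ∀ v → shift (cfg v) < Q
        place≤  : ∀ v → place (cfg v) ≤ Q
        placed  : ∀ v → class (cfg v) < c → 1 ≤ place (cfg v)
        pending : ∀ v → c ≤ class (cfg v) → place (cfg v) ≡ 0
        distinct : ∀ u v → Adj u v → 1 ≤ place (cfg v) → place (cfg u) ≡ place (cfg v) →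
          poly (cfg u) (pred (place (cfg v))) ≢ poly (cfg v) (pred (place (cfg v)))
    open Placing

    Shifted : ℕ → (Fin n → Local) → Set
    Shifted c cfg = Placing c cfg ×
      (∀ v → class (cfg v) ≡ c → sumOver (nbrs v) (λ u → indicator (blocking? (cfg u) (poly (cfg v)))) ≤ h)

    placing-start : ∀ {cfg} → Partitioned G deg≤ M≤P enoughTrials cfg → Placing 0 cfg
    placing-start {cfg} pt = record
      { proper = T.proper pt ; below = T.below pt ; early = T.early pt ; classed = T.classed pt ; defect = T.defect pt
      ; shift< = λ v → subst (_< Q) (sym (proj₁ (T.unplaced pt v))) 0<Q
      ; place≤ = λ v → subst (_≤ Q) (sym (proj₂ (T.unplaced pt v))) z≤n
      ; placed = λ v ()
      ; pending = λ v _ → proj₂ (T.unplaced pt v)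
      ; distinct = λ u v _ 1≤ → contradiction (subst (1 ≤_) (proj₂ (T.unplaced pt v)) 1≤) λ ()
      }
      where module T = Partitioned

    Along-bounded : ∀ B → M ≤ B → P < B → Q < B → ∀ {c cfg} → Placing c cfg → ∀ v → BoundedBy B (cfg v)
    Along-bounded B M≤B P<B Q<B pl v = <-≤-trans (below pl v) M≤B , ≤-<-trans (early pl v) P<B
      , <-trans (shift< pl v) Q<B , ≤-<-trans (place≤ pl v) Q<B

    module _ (c : ℕ) (cfg : Fin n → Local) (pl : Placing c cfg) where
      private
        cfg′ : Fin n → Local
        cfg′ = apply (shiftOp c) cfg

        us : Fin n → List Local
        us v = map cfg (nbrs v)

      newShift-other : ∀ v → class (cfg v) ≢ c → shift (cfg′ v) ≡ shift (cfg v)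
      newShift-other v ≢c with class (cfg v) ≟ c
      ... | yes ≡c = contradiction ≡c ≢c
      ... | no _ = refl

      newShift-own : ∀ v → class (cfg v) ≡ c → shift (cfg′ v) ≡ argmin Q
          (λ σ → sumOver (us v) (λ u → shiftCost (label (cfg v)) u σ))
      newShift-own v ≡c with class (cfg v) ≟ c
      ... | yes _ = refl
      ... | no ≢c = contradiction ≡c ≢c

      newShift< : ∀ v → shift (cfg′ v) < Q
      newShift< v with class (cfg v) ≟ c
      ... | yes _ = argmin< Q (λ σ → sumOver (us v) (λ u → shiftCost (label (cfg v)) u σ)) 0<Q
      ... | no _ = shift< pl v

      poly-kept : ∀ v → 1 ≤ place (cfg v) → ∀ x → poly (cfg′ v) x ≡ poly (cfg v) x
      poly-kept v 1≤ x = cong (λ σ → shifted (label (cfg v)) σ x) (newShift-other v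
        (λ eq → contradiction (subst (1 ≤_) (pending pl v (≤-reflexive (sym eq))) 1≤) λ ()))

      -- A coloured neighbour blocks at most one translate, as the translates differ at every point.
      -- Neighbours of class `c` change their shifts in the same round, but only placed vertices
      -- block, and their polynomials are kept.
      shift-cheap : ∀ v → class (cfg v) ≡ c → sumOver (nbrs v)
          (λ u → indicator (blocking? (cfg′ u) (poly (cfg′ v)))) ≤ h
      shift-cheap v ≡c = begin
        sumOver (nbrs v) (λ u → indicator (blocking? (cfg′ u) (poly (cfg′ v))))
          ≤⟨ sumOver-mono (nbrs v) (λ u _ → indicator-mono (blocking? (cfg′ u) (poly (cfg′ v)))
              (blocking? (cfg u) (shifted a σ*))
               (λ (1≤ , eq) → 1≤ , trans (sym (poly-kept u 1≤ (pred (place (cfg u)))))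
                   (trans eq (cong (λ σ → shifted a σ (pred (place (cfg u)))) (newShift-own v ≡c))))) ⟩
        sumOver (nbrs v) (λ u → shiftCost a (cfg u) σ*) ≡⟨ sumOver-map (nbrs v) cfg (λ u → shiftCost a u σ*) ⟨
        sumOver (us v) (λ u → shiftCost a u σ*)
          ≤⟨ argmin-avoid Q (us v) (shiftCost a) 1 h
               (λ u _ → sumBelow-unique Q (λ σ → blocking? u (shifted a σ))
                  (λ σ τ σ< τ< (_ , p) (_ , q) → hash-shift-injective Q-prime (suc e) a (pred (place u)) σ< τ<
                      (trans (sym p) q)))
               (≤-<-trans (≤-trans (≤-reflexive (*-identityʳ _)) (length-inputs G deg≤ cfg v)) enoughShifts) ⟩
        h ∎
        where
        open ≤-Reasoning
        a = label (cfg v)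
        σ* = argmin Q (λ σ → sumOver (us v) (λ u → shiftCost a u σ))

      shift-step : Shifted c cfg′
      shift-step = record
        { proper = proper pl ; below = below pl ; early = early pl ; classed = classed pl ; defect = defect pl
        ; shift< = newShift< ; place≤ = place≤ pl ; placed = placed pl ; pending = pending pl
        ; distinct = λ u v u∈ 1≤ eq same → distinct pl u v u∈ 1≤ eq
            (trans (sym (poly-kept u (subst (1 ≤_) (sym eq) 1≤) (pred (place (cfg v)))))
                (trans same (poly-kept v 1≤ (pred (place (cfg v))))))
        } , shift-cheap

    num< : ∀ {s} → label s < M → shift s < Q → label s * Q + shift s < Q ^ (2 + e)
    num< a< σ< = <-≤-trans (digit-< (<-≤-trans a< M≤Q) σ<) (≤-reflexive (*-comm (Q ^ suc e) Q))

    module _ (c : ℕ) (cfg : Fin n → Local) (sh : Shifted c cfg) where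
      private
        pl : Placing c cfg
        pl = proj₁ sh

        cfg′ : Fin n → Local
        cfg′ = apply (placeOp c) cfg

        point : Fin n → ℕ
        point v = argmin Q (placeCosts (cfg v) (map cfg (nbrs v)))

      newPlace-other : ∀ v → class (cfg v) ≢ c → place (cfg′ v) ≡ place (cfg v)
      newPlace-other v ≢c with class (cfg v) ≟ c
      ... | yes ≡c = contradiction ≡c ≢c
      ... | no _ = refl

      newPlace-own : ∀ v → class (cfg v) ≡ c → place (cfg′ v) ≡ suc (point v)
      newPlace-own v ≡c with class (cfg v) ≟ c
      ... | yes _ = refl
      ... | no ≢c = contradiction ≡c ≢c

      blocked-total : ∀ s u → sumBelow Q (λ x → indicator (blocked? s u x)) ≤ indicator (blocking? u (poly s))
      blocked-total s u with blocking? u (poly s)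
      ... | yes _ = sumBelow-unique Q (blocked? s u) (λ x y _ _ (p , _) (q , _) → suc-injective (trans (sym p) q))
      ... | no ¬b = ≤-reflexive (sumBelow≡0 Q (λ x _ → ¬⇒indicator≡0 (blocked? s u x)
              (λ (p , q) → ¬b (subst (1 ≤_) (sym p) (s≤s z≤n) , subst (λ t → poly u (pred t) ≡ poly s (pred t))
                  (sym p) q))))

      clash-total : ∀ {u v} → Adj u v → sumBelow Q (λ x → indicator (clash? (cfg v) (cfg u) x)) ≤ indicator
          (outNeighbour? (cfg v) (cfg u)) * suc e
      clash-total {u} {v} u∈ = go (outNeighbour? (cfg v) (cfg u))
        where
        go : (o : Dec (OutNeighbour (cfg v) (cfg u))) → sumBelow Q
            (λ x → indicator (clash? (cfg v) (cfg u) x)) ≤ indicator o * suc e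
        go (yes _) = ≤-trans (≤-trans
          (sumBelow-mono Q (λ x _ → indicator-mono (clash? (cfg v) (cfg u) x)
              (poly (cfg u) x ≟ poly (cfg v) x) proj₂))
          (hash-agreement Q-prime (suc e)
            (λ eq → proper pl u v u∈ (proj₁ (digits-unique Q {{>-nonZero 0<Q}} (shift< pl u) (shift< pl v) eq)))
            (num< {cfg u} (below pl u) (shift< pl u)) (num< {cfg v} (below pl v) (shift< pl v))))
          (≤-reflexive (sym (+-identityʳ (suc e))))
        go (no ¬o) = ≤-reflexive (sumBelow≡0 Q (λ x _ → ¬⇒indicator≡0 (clash? (cfg v) (cfg u) x)
            (λ (o , _) → ¬o o)))

      point-free : ∀ v → class (cfg v) ≡ c → ∀ {u} → Adj u v → placeCost (cfg v) (cfg u) (point v) ≡ 0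
      point-free v ≡c {u} u∈ = sumOver≡0 (map cfg (nbrs v))
          (n≤0⇒n≡0 (argmin-average Q (placeCosts (cfg v) (map cfg (nbrs v))) 0 total)) (∈-map⁺ cfg u∈)
        where
        open ≤-Reasoning
        s = cfg v
        total : sumBelow Q (placeCosts s (map cfg (nbrs v))) < Q * 1
        total = begin-strict
          sumBelow Q (λ x → sumOver (map cfg (nbrs v)) (λ u → placeCost s u x))
            ≡⟨ sumBelow-sumOver Q (map cfg (nbrs v)) (placeCost s) ⟩
          sumOver (map cfg (nbrs v)) (λ u → sumBelow Q (placeCost s u))
            ≡⟨ sumOver-map (nbrs v) cfg (λ u → sumBelow Q (placeCost s u)) ⟩
          sumOver (nbrs v) (λ u → sumBelow Q (placeCost s (cfg u)))
            ≤⟨ sumOver-mono (nbrs v) (λ u u∈ → ≤-trans (≤-reflexive (sumBelow-+ Q _ _))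
                (+-mono-≤ (blocked-total s (cfg u)) (clash-total u∈))) ⟩
          sumOver (nbrs v) (λ u → indicator (blocking? (cfg u) (poly s)) + indicator
              (outNeighbour? s (cfg u)) * suc e)
            ≡⟨ sumOver-+ (nbrs v) (λ u → indicator (blocking? (cfg u) (poly s)))
                (λ u → indicator (outNeighbour? s (cfg u)) * suc e) ⟩
          sumOver (nbrs v) (λ u → indicator (blocking? (cfg u) (poly s))) + sumOver (nbrs v)
              (λ u → indicator (outNeighbour? s (cfg u)) * suc e)
            ≡⟨ cong (sumOver (nbrs v) (λ u → indicator (blocking? (cfg u) (poly s))) +_)
                (sumOver-* (nbrs v) (λ u → indicator (outNeighbour? s (cfg u))) (suc e)) ⟩
          sumOver (nbrs v) (λ u → indicator (blocking? (cfg u) (poly s))) + sumOver (nbrs v)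
              (λ u → indicator (outNeighbour? s (cfg u))) * suc e
            ≤⟨ +-mono-≤ (proj₂ sh v ≡c) (*-monoˡ-≤ (suc e) (defect pl v)) ⟩
          h + β * suc e <⟨ enoughPlaces ⟩
          Q ≡⟨ *-identityʳ Q ⟨
          Q * 1 ∎

      new-distinct : ∀ {u v} → Adj u v → class (cfg v) ≡ c → class (cfg u) ≢ c ⊎
          (class (cfg u) ≡ c × trial (cfg u) ≤ trial (cfg v)) →
        place (cfg′ u) ≡ place (cfg′ v) → poly (cfg u) (point v) ≢ poly (cfg v) (point v)
      new-distinct {u} {v} u∈ ≡c (inj₁ ≢c) eq same = indicator≡0⇒¬ (blocked? (cfg v) (cfg u) (point v))
        (m+n≡0⇒m≡0 _ (point-free v ≡c u∈)) (trans (sym (newPlace-other u ≢c)) (trans eq (newPlace-own v ≡c)) , same)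
      new-distinct {u} {v} u∈ ≡c (inj₂ (u≡c , t≤)) eq same = indicator≡0⇒¬ (clash? (cfg v) (cfg u) (point v))
        (m+n≡0⇒n≡0 (indicator (blocked? (cfg v) (cfg u) (point v))) (point-free v ≡c u∈))
            ((classed pl u , t≤ , trans u≡c (sym ≡c)) , same)

      -- If only one endpoint is placed now, it has avoided the colour of the other. If both are,
      -- the one with the later trial has the other as an out-neighbour and has avoided all
      -- agreements.
      place-distinct : ∀ u v → Adj u v → 1 ≤ place (cfg′ v) → place (cfg′ u) ≡ place (cfg′ v) →
          poly (cfg u) (pred (place (cfg′ v))) ≢ poly (cfg v) (pred (place (cfg′ v)))
      place-distinct u v u∈ 1≤ eq = go (class (cfg u) ≟ c) (class (cfg v) ≟ c)
        where
        at-v : class (cfg v) ≡ c → class (cfg u) ≢ c ⊎ (class (cfg u) ≡ c × trial (cfg u) ≤ trial (cfg v)) →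
          poly (cfg u) (pred (place (cfg′ v))) ≢ poly (cfg v) (pred (place (cfg′ v)))
        at-v v≡c why = subst (λ x → poly (cfg u) x ≢ poly (cfg v) x) (sym (cong pred (newPlace-own v v≡c)))
            (new-distinct u∈ v≡c why eq)
        at-u : class (cfg u) ≡ c → class (cfg v) ≢ c ⊎ (class (cfg v) ≡ c × trial (cfg v) ≤ trial (cfg u)) →
          poly (cfg u) (pred (place (cfg′ v))) ≢ poly (cfg v) (pred (place (cfg′ v)))
        at-u u≡c why = subst (λ x → poly (cfg u) x ≢ poly (cfg v) x)
            (sym (cong pred (trans (sym eq) (newPlace-own u u≡c))))
          (λ same → new-distinct (Graph.sym G u v u∈) u≡c why (sym eq) (sym same))
        go : Dec (class (cfg u) ≡ c) → Dec (class (cfg v) ≡ c) → poly (cfg u) (pred (place (cfg′ v))) ≢ poly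
            (cfg v) (pred (place (cfg′ v)))
        go (no u≢c) (no v≢c) = subst (λ t → poly (cfg u) (pred t) ≢ poly (cfg v) (pred t))
            (sym (newPlace-other v v≢c))
          (distinct pl u v u∈ (subst (1 ≤_) (newPlace-other v v≢c) 1≤)
            (trans (sym (newPlace-other u u≢c)) (trans eq (newPlace-other v v≢c))))
        go (no u≢c) (yes v≡c) = at-v v≡c (inj₁ u≢c)
        go (yes u≡c) (no v≢c) = at-u u≡c (inj₁ v≢c)
        go (yes u≡c) (yes v≡c) with ≤-total (trial (cfg u)) (trial (cfg v))
        ... | inj₁ u≤v = at-v v≡c (inj₂ (u≡c , u≤v))
        ... | inj₂ v≤u = at-u u≡c (inj₂ (v≡c , v≤u))

      place-step : Placing (suc c) cfg′
      place-step = record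
        { proper = proper pl ; below = below pl ; early = early pl ; classed = classed pl ; defect = defect pl
        ; shift< = shift< pl
        ; place≤ = place≤′
        ; placed = placed′
        ; pending = λ v c< → trans (newPlace-other v (λ eq → <-irrefl (sym eq) c<)) (pending pl v (<⇒≤ c<))
        ; distinct = place-distinct
        }
        where
        place≤′ : ∀ v → place (cfg′ v) ≤ Q
        place≤′ v with class (cfg v) ≟ c
        ... | yes _ = argmin< Q (placeCosts (cfg v) (map cfg (nbrs v))) 0<Q
        ... | no _ = place≤ pl v
        placed′ : ∀ v → class (cfg v) < suc c → 1 ≤ place (cfg′ v)
        placed′ v (s≤s ≤c) with class (cfg v) ≟ c
        ... | yes _ = s≤s z≤n
        ... | no ≢c = placed pl v (≤∧≢⇒< ≤c ≢c)

    placeProgram-correct : ∀ B → M ≤ B → P < B → Q < B → ∀ k c {cfg} → Placing c cfg →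
      Along (λ c → ∀ v → BoundedBy B (c v)) (placeProgram k c) (Placing (c + k)) cfg
    placeProgram-correct B M≤B P<B Q<B zero c pl = subst (λ y → Placing y _) (sym (+-identityʳ c)) pl
    placeProgram-correct B M≤B P<B Q<B (suc k) c {cfg} pl =
        Along-bounded B M≤B P<B Q<B pl
      , Along-bounded B M≤B P<B Q<B (proj₁ (shift-step c cfg pl))
      , Along-mono (placeProgram k (suc c)) (λ c′ → subst (λ y → Placing y c′) (sym (+-suc c k)))
          (placeProgram-correct B M≤B P<B Q<B k (suc c) (place-step c _ (shift-step c cfg pl)))

    finalColour-proper : ∀ {cfg} → Placing P cfg → ∀ u v → Adj u v → finalColour (cfg u) ≢ finalColour (cfg v)
    finalColour-proper {cfg} pl u v u∈ eq
      with digits-unique Q {{>-nonZero 0<Q}} {pred (place (cfg u))} {pred (place (cfg v))}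
          (poly< (cfg u) (pred (place (cfg u)))) (poly< (cfg v) (pred (place (cfg v)))) eq
    ... | places , values = distinct pl u v u∈ (placed pl v (class< (cfg v)))
          (trans (sym (positive u)) (trans (cong suc places) (positive v)))
          (trans (cong (poly (cfg u)) (sym places)) values)
      where
      positive : ∀ v → suc (pred (place (cfg v))) ≡ place (cfg v)
      positive v = suc-pred (place (cfg v)) {{>-nonZero (placed pl v (class< (cfg v)))}}

    finalColour< : ∀ {cfg} → Placing P cfg → ∀ v → finalColour (cfg v) < Q * Q
    finalColour< {cfg} pl v = digit-<
      (≤-trans (≤-reflexive (suc-pred (place (cfg v)) {{>-nonZero (placed pl v (class< (cfg v)))}}))
          (place≤ pl v)) (poly< (cfg v) (pred (place (cfg v))))

-- Choice of the parameters

unique-lookup : ∀ {A : Set} {xs : List A} → Unique xs → ∀ {i j} → lookup xs i ≡ lookup xs j → i ≡ j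
unique-lookup (x≢ ∷ u) {Fin.zero} {Fin.zero} eq = refl
unique-lookup {xs = _ ∷ xs} (x≢ ∷ u) {Fin.zero} {Fin.suc j} eq = contradiction eq (All.lookup x≢ (∈-lookup j))
unique-lookup {xs = _ ∷ xs} (x≢ ∷ u) {Fin.suc i} {Fin.zero} eq = contradiction (sym eq) (All.lookup x≢ (∈-lookup i))
unique-lookup (x≢ ∷ u) {Fin.suc i} {Fin.suc j} eq = cong Fin.suc (unique-lookup u eq)

deg≤n : ∀ {n} (G : Graph n) v → Graph.deg G v ≤ n
deg≤n G v = injective⇒≤ (unique-lookup (Graph.unique G v))

-- A power of two serves as the k-th root, at the price of a factor of at most 2.
rootUp : ∀ k N → 1 ≤ k → 1 ≤ N → Σ ℕ λ s → 1 ≤ s × N ≤ s ^ k × s ^ k ≤ 2 ^ k * N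
rootUp k (suc y) 1≤k _ with betweenPowers (2 ^ k) (≤-trans (≤-reflexive (sym (*-identityʳ 2))) (^-monoʳ-≤ 2 1≤k)) y
... | j , y< , ≤y = 2 ^ suc j , m^n>0 2 (suc j)
    , <⇒≤ (<-≤-trans y< (≤-reflexive (sym swap))) , ≤-trans (≤-reflexive swap) (*-monoʳ-≤ (2 ^ k) ≤y)
  where
  swap : (2 ^ suc j) ^ k ≡ (2 ^ k) ^ suc j
  swap = trans (^-*-assoc 2 (suc j) k) (trans (cong (2 ^_) (*-comm (suc j) k)) (sym (^-*-assoc 2 k (suc j))))

^-cancelʳ-≤ : ∀ k → 1 ≤ k → ∀ {a b} → a ^ k ≤ b ^ k → a ≤ b
^-cancelʳ-≤ k 1≤k le = ≮⇒≥ (λ b<a → <⇒≱ (^-monoˡ-< k {{>-nonZero 1≤k}} b<a) le)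

n≤2^n : ∀ n → n ≤ 2 ^ n
n≤2^n n = <⇒≤ (n<2^n n)

^-sum-≤ : ∀ k {a b W} → a ^ k ≤ W → b ^ k ≤ W → (a + b) ^ k ≤ 2 ^ k * W
^-sum-≤ k {a} {b} {W} a≤ b≤ with ≤-total a b
... | inj₁ a≤b = begin
    (a + b) ^ k ≤⟨ ^-monoˡ-≤ k (+-mono-≤ a≤b (≤-reflexive (sym (+-identityʳ b)))) ⟩
    (2 * b) ^ k ≡⟨ ^-distribʳ-* k 2 b ⟩
    2 ^ k * b ^ k ≤⟨ *-monoʳ-≤ (2 ^ k) b≤ ⟩
    2 ^ k * W ∎
  where open ≤-Reasoning
... | inj₂ b≤a = begin
    (a + b) ^ k ≤⟨ ^-monoˡ-≤ k (+-monoʳ-≤ a (≤-trans b≤a (≤-reflexive (sym (+-identityʳ a))))) ⟩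
    (2 * a) ^ k ≡⟨ ^-distribʳ-* k 2 a ⟩
    2 ^ k * a ^ k ≤⟨ *-monoʳ-≤ (2 ^ k) a≤ ⟩
    2 ^ k * W ∎
  where open ≤-Reasoning

record Parameters (p q L d kP kQ C D : ℕ) : Set where
  field
    s β P Q : ℕ
    P-prime : Prime P
    Q-prime : Prime Q
    P-fits : L * D * (L * D) ≤ P ^ suc d
    Q-fits : L * D * (L * D) ≤ Q ^ 4
    trials-suffice : D * (suc d + suc d) < P * suc β
    shifts-suffice : D < Q * suc s
    places-suffice : s + β * 4 < Q
    P≤ : P ≤ kP * D
    Q≤ : Q ≤ kQ * D
    rounds≤ : (P + (P + P)) ^ (2 * q) ≤ C ^ (2 * q) * D ^ (q ∸ p)
    colours≤ : (Q * Q) ^ q ≤ C ^ q * D ^ (q + p)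

module ParameterChoice (p q : ℕ) (p<q : p < q) (L : ℕ) (4≤L : 4 ≤ L) where
  -- From p < q follows D ≤ s^(2q), so 4q digits to base `P` hold (L D)² colours. `k₁` is made for P
  -- · b > D · (2d + 2), given b · s > D for b = β + 1. In `C`, the summand (6A)² is for the
  -- colours, with 6 = 2 · 3 from `^-sum-≤` and `b^≤`, and 6 · 64 · k₁ for the rounds: three per
  -- class, the prime factor 64, and 2 from `rootUp`.
  d k₁ A C : ℕ
  d = 4 * q
  k₁ = L * (suc d + suc d)
  A = 64 * L
  C = 6 * A * (6 * A) + 6 * 64 * k₁

  1≤q : 1 ≤ q
  1≤q = ≤-trans (s≤s z≤n) p<q

  1≤L : 1 ≤ L
  1≤L = ≤-trans (s≤s z≤n) 4≤L

  module _ (D : ℕ) (1≤D : 1 ≤ D) (s : ℕ) (1≤s : 1 ≤ s) (≤s^ : D ^ (q ∸ p) ≤ s ^ (2 * q))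
      (s^≤ : s ^ (2 * q) ≤ 2 ^ (2 * q) * D ^ (q ∸ p)) where
    open ≤-Reasoning
    private
      instance
        s≢0 : NonZero s
        s≢0 = >-nonZero 1≤s
        D≢0 : NonZero D
        D≢0 = >-nonZero 1≤D
        L≢0 : NonZero L
        L≢0 = >-nonZero 1≤L
      β b : ℕ
      β = D / s
      b = suc β

    1≤2q : 1 ≤ 2 * q
    1≤2q = ≤-trans 1≤q (m≤n*m q 2)

    D<bs : D < b * s
    D<bs = begin-strict
      D ≡⟨ m≡m%n+[m/n]*n D s ⟩
      D % s + β * s <⟨ +-monoˡ-< (β * s) (m%n<n D s) ⟩
      b * s ∎
      
    s≤2D : s ≤ 2 * D
    s≤2D = ^-cancelʳ-≤ (2 * q) 1≤2q (begin
      s ^ (2 * q) ≤⟨ s^≤ ⟩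
      2 ^ (2 * q) * D ^ (q ∸ p) ≤⟨ *-monoʳ-≤ (2 ^ (2 * q)) (^-monoʳ-≤ D (≤-trans (m∸n≤m q p) (m≤n*m q 2))) ⟩
      2 ^ (2 * q) * D ^ (2 * q) ≡⟨ ^-distribʳ-* (2 * q) 2 D ⟨
      (2 * D) ^ (2 * q) ∎)

    bs≤3D : b * s ≤ 3 * D
    bs≤3D = begin
      s + β * s ≤⟨ +-mono-≤ s≤2D (m/n*n≤m D s) ⟩
      2 * D + D ≡⟨ ar D ⟩
      3 * D ∎
      where
      ar : ∀ D → 2 * D + D ≡ 3 * D
      ar = solve-∀

    -- This is where the exponent 1 + ε arises: b · s ≤ 3D is raised to the power 2q = (q + p) + (q
    -- - p), and the lower bound D^(q-p) for s^(2q) is cancelled.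
    b^≤ : b ^ (2 * q) ≤ 3 ^ (2 * q) * D ^ (q + p)
    b^≤ = *-cancelʳ-≤ (b ^ (2 * q)) (3 ^ (2 * q) * D ^ (q + p)) (D ^ (q ∸ p)) {{m^n≢0 D (q ∸ p)}} (begin
      b ^ (2 * q) * D ^ (q ∸ p) ≤⟨ *-monoʳ-≤ (b ^ (2 * q)) ≤s^ ⟩
      b ^ (2 * q) * s ^ (2 * q) ≡⟨ ^-distribʳ-* (2 * q) b s ⟨
      (b * s) ^ (2 * q) ≤⟨ ^-monoˡ-≤ (2 * q) bs≤3D ⟩
      (3 * D) ^ (2 * q) ≡⟨ ^-distribʳ-* (2 * q) 3 D ⟩
      3 ^ (2 * q) * D ^ (2 * q) ≡⟨ cong (λ t → 3 ^ (2 * q) * D ^ t) split ⟩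
      3 ^ (2 * q) * D ^ ((q + p) + (q ∸ p)) ≡⟨ cong (3 ^ (2 * q) *_) (^-distribˡ-+-* D (q + p) (q ∸ p)) ⟩
      3 ^ (2 * q) * (D ^ (q + p) * D ^ (q ∸ p)) ≡⟨ *-assoc (3 ^ (2 * q)) (D ^ (q + p)) (D ^ (q ∸ p)) ⟨
      3 ^ (2 * q) * D ^ (q + p) * D ^ (q ∸ p) ∎)
      where
      split : 2 * q ≡ (q + p) + (q ∸ p)
      split = trans (cong (q +_) (trans (+-identityʳ q) (sym (m+[n∸m]≡n (<⇒≤ p<q))))) (sym (+-assoc q p (q ∸ p)))

    s^≤′ : s ^ (2 * q) ≤ 3 ^ (2 * q) * D ^ (q + p)
    s^≤′ = ≤-trans s^≤ (*-mono-≤ (^-monoˡ-≤ (2 * q) (n≤1+n 2)) (^-monoʳ-≤ D (≤-trans (m∸n≤m q p) (m≤m+n q p))))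

    b≤2D : b ≤ 2 * D
    b≤2D = begin
      suc β ≤⟨ s≤s (≤-trans (m≤m*n β s) (m/n*n≤m D s)) ⟩
      1 + D ≤⟨ +-monoˡ-≤ D 1≤D ⟩
      D + D ≡⟨ cong (D +_) (+-identityʳ D) ⟨
      2 * D ∎

    b+s≤4D : b + s ≤ 4 * D
    b+s≤4D = ≤-trans (+-mono-≤ b≤2D s≤2D) (≤-reflexive (ar D))
      where
      ar : ∀ D → 2 * D + 2 * D ≡ 4 * D
      ar = solve-∀

    [xy]²≤ : ∀ {x y} → D ≤ y → L ≤ x → L * D * (L * D) ≤ (x * y) ^ 2
    [xy]²≤ {x} {y} D≤y L≤x = ≤-trans (*-mono-≤ (*-mono-≤ L≤x D≤y) (*-mono-≤ L≤x D≤y))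
        (≤-reflexive (cong (x * y *_) (sym (*-identityʳ (x * y)))))

    parametersFor : (P Q : ℕ) → Prime P → Prime Q → k₁ * s < P → P ≤ 64 * (k₁ * s) → L * (b + s) < Q → Q ≤ 64 *
        (L * (b + s)) → Parameters p q L d (128 * k₁) (A * 4) C D
    parametersFor P Q P-prime Q-prime <P P≤ <Q Q≤ = record
      { s = s ; β = β ; P = P ; Q = Q ; P-prime = P-prime ; Q-prime = Q-prime
      ; P-fits = P-fits ; Q-fits = Q-fits
      ; trials-suffice = begin-strict
          D * (suc d + suc d) <⟨ *-monoˡ-< (suc d + suc d) D<bs ⟩
          b * s * (suc d + suc d) ≤⟨ m≤n*m (b * s * (suc d + suc d)) L ⟩
          L * (b * s * (suc d + suc d)) ≡⟨ ar₁ L b s (suc d + suc d) ⟩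
          L * (suc d + suc d) * s * b ≤⟨ *-monoˡ-≤ b (<⇒≤ <P) ⟩
          P * b ∎
      ; shifts-suffice = begin-strict
          D <⟨ D<bs ⟩
          b * s ≤⟨ *-mono-≤ (≤-trans (≤-trans (m≤m+n b s) (m≤n*m (b + s) L)) (<⇒≤ <Q)) (n≤1+n s) ⟩
          Q * suc s ∎
      ; places-suffice = begin-strict
          s + β * 4 ≤⟨ +-mono-≤ (m≤n*m s 4) (*-monoˡ-≤ 4 (n≤1+n β)) ⟩
          4 * s + b * 4 ≡⟨ ar₂ s b ⟩
          4 * (b + s) ≤⟨ *-monoˡ-≤ (b + s) 4≤L ⟩
          L * (b + s) <⟨ <Q ⟩
          Q ∎
      ; P≤ = begin
          P ≤⟨ P≤ ⟩
          64 * (k₁ * s) ≤⟨ *-monoʳ-≤ 64 (*-monoʳ-≤ k₁ s≤2D) ⟩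
          64 * (k₁ * (2 * D)) ≡⟨ ar₃ k₁ D ⟩
          128 * k₁ * D ∎
      ; Q≤ = begin
          Q ≤⟨ Q≤ ⟩
          64 * (L * (b + s)) ≤⟨ *-monoʳ-≤ 64 (*-monoʳ-≤ L b+s≤4D) ⟩
          64 * (L * (4 * D)) ≡⟨ ar₄ L D ⟩
          A * 4 * D ∎
      ; rounds≤ = begin
          (P + (P + P)) ^ (2 * q) ≤⟨ ^-monoˡ-≤ (2 * q) (begin
            P + (P + P) ≡⟨ ar₅ P ⟩
            3 * P ≤⟨ *-monoʳ-≤ 3 P≤ ⟩
            3 * (64 * (k₁ * s)) ≡⟨ ar₆ k₁ s ⟩
            3 * 64 * k₁ * s ∎) ⟩
          (3 * 64 * k₁ * s) ^ (2 * q) ≡⟨ ^-distribʳ-* (2 * q) (3 * 64 * k₁) s ⟩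
          (3 * 64 * k₁) ^ (2 * q) * s ^ (2 * q) ≤⟨ *-monoʳ-≤ ((3 * 64 * k₁) ^ (2 * q)) s^≤ ⟩
          (3 * 64 * k₁) ^ (2 * q) * (2 ^ (2 * q) * D ^ (q ∸ p)) ≡⟨ *-assoc ((3 * 64 * k₁) ^ (2 * q))
              (2 ^ (2 * q)) (D ^ (q ∸ p)) ⟨
          (3 * 64 * k₁) ^ (2 * q) * 2 ^ (2 * q) * D ^ (q ∸ p) ≡⟨ cong (_* D ^ (q ∸ p))
              (^-distribʳ-* (2 * q) (3 * 64 * k₁) 2) ⟨
          (3 * 64 * k₁ * 2) ^ (2 * q) * D ^ (q ∸ p) ≤⟨ *-monoˡ-≤ (D ^ (q ∸ p))
              (^-monoˡ-≤ (2 * q) (≤-trans (≤-reflexive (ar₇ k₁)) (m≤n+m (6 * 64 * k₁) (6 * A * (6 * A))))) ⟩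
          C ^ (2 * q) * D ^ (q ∸ p) ∎
      ; colours≤ = begin
          (Q * Q) ^ q ≡⟨ square Q ⟩
          Q ^ (2 * q) ≤⟨ ^-monoˡ-≤ (2 * q) (≤-trans Q≤ (≤-reflexive (sym (*-assoc 64 L (b + s))))) ⟩
          (A * (b + s)) ^ (2 * q) ≡⟨ ^-distribʳ-* (2 * q) A (b + s) ⟩
          A ^ (2 * q) * (b + s) ^ (2 * q) ≤⟨ *-monoʳ-≤ (A ^ (2 * q)) (^-sum-≤ (2 * q) b^≤ s^≤′) ⟩
          A ^ (2 * q) * (2 ^ (2 * q) * (3 ^ (2 * q) * D ^ (q + p))) ≡⟨ ar₈ (A ^ (2 * q)) (2 ^ (2 * q))
              (3 ^ (2 * q)) (D ^ (q + p)) ⟩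
          (2 ^ (2 * q) * 3 ^ (2 * q)) * A ^ (2 * q) * D ^ (q + p) ≡⟨ cong (λ t → t * A ^ (2 * q) * D ^ (q + p))
              (^-distribʳ-* (2 * q) 2 3) ⟨
          6 ^ (2 * q) * A ^ (2 * q) * D ^ (q + p) ≡⟨ cong (_* D ^ (q + p)) (^-distribʳ-* (2 * q) 6 A) ⟨
          (6 * A) ^ (2 * q) * D ^ (q + p) ≡⟨ cong (_* D ^ (q + p)) (square (6 * A)) ⟨
          (6 * A * (6 * A)) ^ q * D ^ (q + p) ≤⟨ *-monoˡ-≤ (D ^ (q + p))
              (^-monoˡ-≤ q (m≤m+n (6 * A * (6 * A)) (6 * 64 * k₁))) ⟩
          C ^ q * D ^ (q + p) ∎
      }
      where
      ar₁ : ∀ l b s e → l * (b * s * e) ≡ l * e * s * b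
      ar₁ = solve-∀
      ar₂ : ∀ s b → 4 * s + b * 4 ≡ 4 * (b + s)
      ar₂ = solve-∀
      ar₃ : ∀ k D → 64 * (k * (2 * D)) ≡ 128 * k * D
      ar₃ = solve-∀
      ar₄ : ∀ L D → 64 * (L * (4 * D)) ≡ 64 * L * 4 * D
      ar₄ = solve-∀
      ar₅ : ∀ P → P + (P + P) ≡ 3 * P
      ar₅ = solve-∀
      ar₆ : ∀ k s → 3 * (64 * (k * s)) ≡ 3 * 64 * k * s
      ar₆ = solve-∀
      ar₇ : ∀ k → 3 * 64 * k * 2 ≡ 6 * 64 * k
      ar₇ = solve-∀
      ar₈ : ∀ a x y z → a * (x * (y * z)) ≡ (x * y) * a * z
      ar₈ = solve-∀
      square : ∀ x → (x * x) ^ q ≡ x ^ (2 * q)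
      square x = trans (cong (λ t → (x * t) ^ q) (sym (*-identityʳ x))) (^-*-assoc x 2 q)
      1<P : 1 ≤ P
      1<P = <⇒≤ (prime>1 P-prime)
      D≤s^ : D ≤ s ^ (2 * q)
      D≤s^ = ≤-trans (≤-trans (≤-reflexive (sym (*-identityʳ D))) (^-monoʳ-≤ D (m<n⇒0<n∸m p<q))) ≤s^
      P-fits : L * D * (L * D) ≤ P ^ suc d
      P-fits = begin
        L * D * (L * D) ≤⟨ [xy]²≤ {L ^ (2 * q)} {s ^ (2 * q)} D≤s^
            (≤-trans (≤-reflexive (sym (*-identityʳ L))) (^-monoʳ-≤ L 1≤2q)) ⟩
        (L ^ (2 * q) * s ^ (2 * q)) ^ 2 ≡⟨ cong (_^ 2) (^-distribʳ-* (2 * q) L s) ⟨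
        ((L * s) ^ (2 * q)) ^ 2 ≡⟨ ^-*-assoc (L * s) (2 * q) 2 ⟩
        (L * s) ^ (2 * q * 2) ≤⟨ ^-monoˡ-≤ (2 * q * 2) (≤-trans (*-monoˡ-≤ s (m≤m*n L (suc d + suc d))) (<⇒≤ <P)) ⟩
        P ^ (2 * q * 2) ≤⟨ ^-monoʳ-≤ P {{>-nonZero 1<P}} (≤-trans (≤-reflexive (ar₉ q)) (n≤1+n d)) ⟩
        P ^ suc d ∎
        where
        ar₉ : ∀ q → 2 * q * 2 ≡ 4 * q
        ar₉ = solve-∀
      Q-fits : L * D * (L * D) ≤ Q ^ 4
      Q-fits = begin
        L * D * (L * D) ≤⟨ [xy]²≤ {L ^ 2} {(b + s) ^ 2} D≤[b+s]² (m≤m*n L (L ^ 1) {{m^n≢0 L 1}}) ⟩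
        (L ^ 2 * (b + s) ^ 2) ^ 2 ≡⟨ cong (_^ 2) (^-distribʳ-* 2 L (b + s)) ⟨
        ((L * (b + s)) ^ 2) ^ 2 ≡⟨ ^-*-assoc (L * (b + s)) 2 2 ⟩
        (L * (b + s)) ^ 4 ≤⟨ ^-monoˡ-≤ 4 (<⇒≤ <Q) ⟩
        Q ^ 4 ∎
        where
        D≤[b+s]² : D ≤ (b + s) ^ 2
        D≤[b+s]² = ≤-trans (<⇒≤ D<bs) (*-mono-≤ (m≤m+n b s)
            (≤-trans (m≤n+m s b) (≤-reflexive (sym (*-identityʳ (b + s))))))

  abstract
    parameters : ∀ D → 1 ≤ D → Parameters p q L d (128 * k₁) (A * 4) C D
    parameters D 1≤D = choose (rootUp (2 * q) (D ^ (q ∸ p)) (≤-trans 1≤q (m≤n*m q 2))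
        (m^n>0 D {{>-nonZero 1≤D}} (q ∸ p)))
      where
      choose : (Σ ℕ λ s → 1 ≤ s × D ^ (q ∸ p) ≤ s ^ (2 * q) × s ^ (2 * q) ≤ 2 ^ (2 * q) * D ^ (q ∸ p))
          → Parameters p q L d (128 * k₁) (A * 4) C D
      choose (s , 1≤s , ≤s^ , s^≤) = primes (primeAbove (k₁ * s))
          (primeAbove (L * (suc ((D / s) {{>-nonZero 1≤s}}) + s)))
        where
        primes : (Σ ℕ λ P → Prime P × k₁ * s < P × (1 ≤ k₁ * s → P ≤ 64 * (k₁ * s))) →
                 (Σ ℕ λ Q → Prime Q × L * (suc ((D / s) {{>-nonZero 1≤s}}) + s) < Q ×
                    (1 ≤ L * (suc ((D / s) {{>-nonZero 1≤s}}) + s) → Q ≤ 64 *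
                        (L * (suc ((D / s) {{>-nonZero 1≤s}}) + s)))) →
                 Parameters p q L d (128 * k₁) (A * 4) C D
        primes (P , P-prime , <P , P≤) (Q , Q-prime , <Q , Q≤) = parametersFor D 1≤D s 1≤s ≤s^ s^≤ P Q P-prime Q-prime
          <P (P≤ (*-mono-≤ (*-mono-≤ 1≤L (s≤s z≤n)) 1≤s)) <Q (Q≤ (*-mono-≤ 1≤L (s≤s z≤n)))

-- Message sizes and assembly of the two algorithms

-- Because c ≤ 2^c ≤ b^c, a constant factor becomes a constant exponent. So bounds of the form
-- constant times a power of `D` fit below a fixed power of n + 1, even for small n.
const*≤ : ∀ {b} c {x k} → 2 ≤ b → x ≤ b ^ k → c * x ≤ b ^ (c + k)
const*≤ {b} c {x} {k} 2≤b x≤ = begin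
  c * x ≤⟨ *-mono-≤ (≤-trans (n≤2^n c) (^-monoˡ-≤ c 2≤b)) x≤ ⟩
  b ^ c * b ^ k ≡⟨ ^-distribˡ-+-* b c k ⟨
  b ^ (c + k) ∎
  where open ≤-Reasoning

≤b^⇒<b^ : ∀ {b x k l} → 2 ≤ b → k < l → x ≤ b ^ k → x < b ^ l
≤b^⇒<b^ {b} 2≤b k<l x≤ = ≤-<-trans x≤ (^-monoʳ-< b 2≤b k<l)

-- The three summands replace 2^(4 log D), 2^(c + 42) and 2^((2 + c) log n) by powers of n + 1,
-- using that `D`, 2 and n are at most n + 1.
linialExponent : ℕ → ℕ
linialExponent c = 4 + (c + 42) + (2 + c)

module Assembly (c K L : ℕ) (K-large : 2 ^ (2 * c + 44) ≤ K) (64K≤L : 64 * K ≤ L) where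

  module _ {n Δ : ℕ} (G : Graph n) (max : MaxDegree G Δ) where
    open Graph G using (Adj; deg)

    D : ℕ
    D = Δ ⊔ 1

    1≤D : 1 ≤ D
    1≤D = m≤n⊔m Δ 1

    Δ≤D : Δ ≤ D
    Δ≤D = m≤m⊔n Δ 1

    1≤n : 1 ≤ n
    1≤n = inhabited (proj₁ (proj₂ max))
      where
      inhabited : ∀ {n} → Fin n → 1 ≤ n
      inhabited {suc n} _ = s≤s z≤n

    2≤n+1 : 2 ≤ suc n
    2≤n+1 = s≤s 1≤n

    D≤n+1 : D ≤ suc n ^ 1
    D≤n+1 = ≤-trans (⊔-lub (m≤n⇒m≤1+n (subst (_≤ n) (proj₂ (proj₂ max)) (deg≤n G (proj₁ (proj₂ max))))) (s≤s z≤n))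
      (≤-reflexive (sym (*-identityʳ (suc n))))

    linialRoom : 2 ^ (LinialProgram.X c K D + (2 + c) * ⌊log₂ n ⌋) ≤ suc n ^ linialExponent c
    linialRoom = begin
      2 ^ (4 * ⌊log₂ D ⌋ + (c + 42) + (2 + c) * ⌊log₂ n ⌋)
        ≡⟨ trans (^-distribˡ-+-* 2 (4 * ⌊log₂ D ⌋ + (c + 42)) ((2 + c) * ⌊log₂ n ⌋))
             (cong₂ _*_ (^-distribˡ-+-* 2 (4 * ⌊log₂ D ⌋) (c + 42)) refl) ⟩
      2 ^ (4 * ⌊log₂ D ⌋) * 2 ^ (c + 42) * 2 ^ ((2 + c) * ⌊log₂ n ⌋)
        ≤⟨ *-mono-≤ (*-mono-≤ (power 4 1≤D (≤-trans D≤n+1 (≤-reflexive (*-identityʳ (suc n)))))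
            (^-monoˡ-≤ (c + 42) 2≤n+1)) (power (2 + c) 1≤n (n≤1+n n)) ⟩
      suc n ^ 4 * suc n ^ (c + 42) * suc n ^ (2 + c)
        ≡⟨ trans (^-distribˡ-+-* (suc n) (4 + (c + 42)) (2 + c))
            (cong (_* suc n ^ (2 + c)) (^-distribˡ-+-* (suc n) 4 (c + 42))) ⟨
      suc n ^ linialExponent c ∎
      where
      open ≤-Reasoning
      power : ∀ e {x} → 1 ≤ x → x ≤ suc n → 2 ^ (e * ⌊log₂ x ⌋) ≤ suc n ^ e
      power e {x} 1≤x x≤ = begin
        2 ^ (e * ⌊log₂ x ⌋) ≡⟨ cong (2 ^_) (*-comm e ⌊log₂ x ⌋) ⟩
        2 ^ (⌊log₂ x ⌋ * e) ≡⟨ ^-*-assoc 2 ⌊log₂ x ⌋ e ⟨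
        (2 ^ ⌊log₂ x ⌋) ^ e ≤⟨ ^-monoˡ-≤ e (≤-trans (2^log₂≤ 1≤x) x≤) ⟩
        suc n ^ e ∎

    linial-along : ∀ B {cfg} → 2 ^ (LinialProgram.X c K D + (2 + c) * ⌊log₂ n ⌋) ≤ B → Coloured G (proj₁ max)
        (suc n ^ c) cfg →
      Execution.Along G (λ cfg → ∀ v → BoundedBy B (cfg v)) (LinialProgram.linialProgram c K D n)
          (Coloured G (proj₁ max) (L * D * (L * D))) cfg
    linial-along B room col = Execution.Along-mono G (LinialProgram.linialProgram c K D n)
      (λ _ → Coloured-mono G (proj₁ max) (*-mono-≤ (*-monoˡ-≤ D 64K≤L) (*-monoˡ-≤ D 64K≤L)))
      (LinialProgram.linialProgram-correct c K D G (proj₁ max) 1≤D Δ≤D K-large B room col)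

    start-coloured : (ident : Fin n → ℕ) → Injective _≡_ _≡_ ident → (∀ v → ident v < suc n ^ c) →
      Coloured G (proj₁ max) (suc n ^ c) (λ v → local (ident v) 0 0 0)
    start-coloured ident inj ident< = record
      { proper = λ u v u∈ eq → Graph.irrefl G v (subst (_∈ Graph.nbrs G v) (inj eq) u∈)
      ; below = ident<
      ; fresh = λ v → refl
      }

  quadraticAlgorithm : ℕ → Algorithm
  quadraticAlgorithm = Broadcast.algorithm (λ n Δ → LinialProgram.linialProgram c K (Δ ⊔ 1) n) (λ _ _ → label)

  quadratic : ∀ p q → 0 < q → q ≤ p → (k : ℕ) → linialExponent c ≤ k → Solves (quadraticAlgorithm k)
    p q c (k * 4) (L * L)
  quadratic p q 0<q q≤p k room n Δ G ident max inj ident< = bandwidth G Δ ident along , proper , colours , few-rounds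
    where
    open Broadcast (λ n Δ → LinialProgram.linialProgram c K (Δ ⊔ 1) n) (λ _ _ → label) k
    open LinialProgram c K (Δ ⊔ 1) using (linialProgram; length-linialProgram)
    open Run algorithm G Δ ident using (Proper; colour)
    along : Execution.Along G (Bounded G Δ ident) (linialProgram n)
        (Coloured G (proj₁ max) (L * D G max * (L * D G max))) (λ v → local (ident v) 0 0 0)
    along = linial-along G max (suc n ^ k) (≤-trans (linialRoom G max) (^-monoʳ-≤ (suc n) room))
      (start-coloured G max ident inj ident<)
    result = outcome G Δ ident along
    proper : Proper
    proper u v u∈ eq = Coloured.proper (proj₁ (proj₂ result)) u v u∈
        (trans (sym (proj₂ (proj₂ result) u)) (trans eq (proj₂ (proj₂ result) v)))
    colours : ∀ v → colour v ^ q < (L * L) ^ q * (Δ ⊔ 1) ^ (q + p)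
    colours v = begin-strict
      colour v ^ q ≡⟨ cong (_^ q) (proj₂ (proj₂ result) v) ⟩
      label (proj₁ result v) ^ q <⟨ ^-monoˡ-< q {{>-nonZero 0<q}} (Coloured.below (proj₁ (proj₂ result)) v) ⟩
      (L * D′ * (L * D′)) ^ q ≡⟨ cong (_^ q) (ar L D′) ⟩
      (L * L * (D′ * D′)) ^ q ≡⟨ ^-distribʳ-* q (L * L) (D′ * D′) ⟩
      (L * L) ^ q * (D′ * D′) ^ q ≡⟨ cong ((L * L) ^ q *_)
          (trans (^-distribʳ-* q D′ D′) (sym (^-distribˡ-+-* D′ q q))) ⟩
      (L * L) ^ q * D′ ^ (q + q) ≤⟨ *-monoʳ-≤ ((L * L) ^ q)
          (^-monoʳ-≤ D′ {{>-nonZero (1≤D G max)}} (+-monoʳ-≤ q q≤p)) ⟩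
      (L * L) ^ q * D′ ^ (q + p) ∎
      where
      open ≤-Reasoning
      D′ = D G max
      ar : ∀ l d → l * d * (l * d) ≡ l * l * (d * d)
      ar = solve-∀
    few-rounds : (length (linialProgram n) ∸ logStar n) ^ (2 * q) * (Δ ⊔ 1) ^ (p ∸ q) ≤ (L * L) ^ (2 * q) *
        (Δ ⊔ 1) ^ (q ∸ p)
    -- The difference is exactly 0, the only value that the bound admits for p > q and large Δ.
    few-rounds = subst (λ r → r ^ (2 * q) * (Δ ⊔ 1) ^ (p ∸ q) ≤ (L * L) ^ (2 * q) * (Δ ⊔ 1) ^ (q ∸ p))
      (sym (trans (cong (_∸ logStar n) (length-linialProgram n)) (n∸n≡0 (logStar n))))
      (≤-trans (≤-reflexive (cong (_* (Δ ⊔ 1) ^ (p ∸ q)) (0^n≡0 (≤-trans 0<q (m≤n*m q 2))))) z≤n)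
      where
      0^n≡0 : ∀ {k} → 1 ≤ k → 0 ^ k ≡ 0
      0^n≡0 (s≤s _) = refl

  module Sublinear (p q : ℕ) (p<q : p < q) (d kP kQ C k : ℕ)
           (k-large : linialExponent c + (L * L + 2) + (kP + 2) + (kQ + 2) ≤ k)
           (choose : ∀ D → 1 ≤ D → Parameters p q L d kP kQ C D) where

    parametersOf : ∀ Δ → Parameters p q L d kP kQ C (Δ ⊔ 1)
    parametersOf Δ = choose (Δ ⊔ 1) (m≤n⊔m Δ 1)

    trialPart placePart : ℕ → List Op
    trialPart Δ = Trials.trialProgram P-prime d β P 0
      where open Parameters (parametersOf Δ)
    placePart Δ = Placement.placeProgram P-prime d β Q-prime 3 s P 0
      where open Parameters (parametersOf Δ)

    fullProgram : ℕ → ℕ → List Op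
    fullProgram n Δ = LinialProgram.linialProgram c K (Δ ⊔ 1) n ++ (trialPart Δ ++ placePart Δ)

    colourOf : ℕ → ℕ → Local → ℕ
    colourOf n Δ = Placement.finalColour P-prime d β Q-prime 3 s
      where open Parameters (parametersOf Δ)

    sublinearAlgorithm : Algorithm
    sublinearAlgorithm = Broadcast.algorithm fullProgram colourOf k

    sublinear : Solves sublinearAlgorithm p q c (k * 4) C
    sublinear n Δ G ident max inj ident< = bandwidth G Δ ident along , proper , colours , few-rounds
      where
      open Parameters (parametersOf Δ)
      open Broadcast fullProgram colourOf k
      open LinialProgram c K (Δ ⊔ 1) using (linialProgram; length-linialProgram)
      open Run algorithm G Δ ident using (Proper; colour)
      open Execution G
      module Tr = Trials P-prime d β
      module Pl = Placement P-prime d β Q-prime 3 s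
      D′ = D G max
      deg≤ = proj₁ max
      B = suc n ^ k
      2≤b = 2≤n+1 G max

      enoughTrials : Δ * (suc d + suc d) < P * suc β
      enoughTrials = ≤-<-trans (*-monoˡ-≤ (suc d + suc d) (Δ≤D G max)) trials-suffice
      enoughShifts : Δ < Q * suc s
      enoughShifts = ≤-<-trans (Δ≤D G max) shifts-suffice

      room : ∀ {x l} → l ≤ linialExponent c + (L * L + 2) + (kP + 2) + (kQ + 2) → x ≤ suc n ^ l → x ≤ B
      room l≤ x≤ = ≤-trans x≤ (^-monoʳ-≤ (suc n) (≤-trans l≤ k-large))

      M≤B : L * D′ * (L * D′) ≤ B
      M≤B = room (≤-trans (m≤n+m (L * L + 2) (linialExponent c)) (≤-trans (m≤m+n _ (kP + 2)) (m≤m+n _ (kQ + 2))))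
        (≤-trans (≤-reflexive (ar L D′)) (const*≤ (L * L) 2≤b
            (≤-trans (*-mono-≤ (D≤n+1 G max) (D≤n+1 G max)) (≤-reflexive (sym (^-distribˡ-+-* (suc n) 1 1))))))
        where
        ar : ∀ l d → l * d * (l * d) ≡ l * l * (d * d)
        ar = solve-∀
      P<B : P < B
      P<B = ≤b^⇒<b^ 2≤b (≤-trans (≤-trans (≤-reflexive (sym (+-suc kP 1)))
          (≤-trans (m≤n+m (kP + 2) (linialExponent c + (L * L + 2))) (m≤m+n _ (kQ + 2)))) k-large)
        (≤-trans P≤ (const*≤ kP 2≤b (D≤n+1 G max)))
      Q<B : Q < B
      Q<B = ≤b^⇒<b^ 2≤b (≤-trans (≤-trans (≤-reflexive (sym (+-suc kQ 1)))
          (m≤n+m (kQ + 2) (linialExponent c + (L * L + 2) + (kP + 2)))) k-large)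
        (≤-trans Q≤ (const*≤ kQ 2≤b (D≤n+1 G max)))

      along : Along (Bounded G Δ ident) (fullProgram n Δ)
          (Pl.Placing G deg≤ P-fits enoughTrials Q-fits enoughShifts places-suffice P) (λ v → local (ident v) 0 0 0)
      along = Along-++ (linialProgram n) (trialPart Δ ++ placePart Δ) (Along-mono (linialProgram n)
        (λ _ col → Along-++ (trialPart Δ) (placePart Δ) (Along-mono (trialPart Δ)
          (λ _ tr → Pl.placeProgram-correct G deg≤ P-fits enoughTrials Q-fits enoughShifts places-suffice B M≤B P<B Q<B P 0
            (Pl.placing-start G deg≤ P-fits enoughTrials Q-fits enoughShifts places-suffice
                (Tr.trying-end G deg≤ P-fits enoughTrials _ tr)))
          (Tr.trialProgram-correct G deg≤ P-fits enoughTrials B M≤B P<B P 0 ≤-refl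
              (Tr.trying-start G deg≤ P-fits enoughTrials col))))
        (linial-along G max B
          (room (≤-trans (m≤m+n (linialExponent c) (L * L + 2))
              (≤-trans (m≤m+n _ (kP + 2)) (m≤m+n _ (kQ + 2)))) (linialRoom G max))
          (start-coloured G max ident inj ident<)))

      result = outcome G Δ ident along
      proper : Proper
      proper u v u∈ eq = Pl.finalColour-proper G deg≤ P-fits enoughTrials Q-fits enoughShifts places-suffice
          (proj₁ (proj₂ result)) u v u∈
        (trans (sym (proj₂ (proj₂ result) u)) (trans eq (proj₂ (proj₂ result) v)))
      colours : ∀ v → colour v ^ q < C ^ q * D′ ^ (q + p)
      colours v = begin-strict
        colour v ^ q ≡⟨ cong (_^ q) (proj₂ (proj₂ result) v) ⟩
        Pl.finalColour (proj₁ result v) ^ q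
          <⟨ ^-monoˡ-< q {{>-nonZero (≤-trans (s≤s z≤n) p<q)}}
              (Pl.finalColour< G deg≤ P-fits enoughTrials Q-fits enoughShifts places-suffice
              (proj₁ (proj₂ result)) v) ⟩
        (Q * Q) ^ q ≤⟨ colours≤ ⟩
        C ^ q * D′ ^ (q + p) ∎
        where open ≤-Reasoning
      T≡ : length (fullProgram n Δ) ≡ logStar n + (P + (P + P))
      T≡ = trans (length-++ (linialProgram n)) (cong₂ _+_ (length-linialProgram n)
        (trans (length-++ (trialPart Δ)) (cong₂ _+_ (Tr.length-trialProgram P 0) (Pl.length-placeProgram P 0))))
      few-rounds : (length (fullProgram n Δ) ∸ logStar n) ^ (2 * q) * D′ ^ (p ∸ q) ≤ C ^ (2 * q) * D′ ^ (q ∸ p)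
      few-rounds = subst₂ (λ r e → r ^ (2 * q) * D′ ^ e ≤ C ^ (2 * q) * D′ ^ (q ∸ p))
        (sym (trans (cong (_∸ logStar n) T≡) (m+n∸m≡n (logStar n) (P + (P + P)))))
        (sym (m≤n⇒m∸n≡0 (<⇒≤ p<q)))
        (≤-trans (≤-reflexive (*-identityʳ _)) rounds≤)

solvable : ∀ p q → 0 < q → ∀ c K → 2 ^ (2 * c + 44) ≤ K → Dec (q ≤ p) →
  Σ Algorithm λ A → Σ ℕ λ k → Σ ℕ λ C → Solves A p q c k C
solvable p q 0<q c K K-large (yes q≤p) = Assembly.quadraticAlgorithm c K L K-large ≤-refl k , k * 4 , L * L , Assembly.quadratic c K L K-large ≤-refl p q 0<q q≤p k ≤-refl
  where
  k L : ℕ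
  k = linialExponent c
  L = 64 * K
solvable p q 0<q c K K-large (no q≰p) = Sub.sublinearAlgorithm , k * 4 , S.C , Sub.sublinear
  where
  p<q = ≰⇒> q≰p
  L : ℕ
  L = 64 * K
  4≤L : 4 ≤ L
  4≤L = *-mono-≤ {4} {64} {1} (s≤s (s≤s (s≤s (s≤s z≤n)))) (≤-trans (m^n>0 2 (2 * c + 44)) K-large)
  module S = ParameterChoice p q p<q L 4≤L
  k : ℕ
  k = linialExponent c + (L * L + 2) + (128 * S.k₁ + 2) + (S.A * 4 + 2)
  module Sub = Assembly.Sublinear c K L K-large ≤-refl p q p<q S.d (128 * S.k₁) (S.A * 4) S.C k ≤-refl S.parameters

theorem3 : (p q : ℕ) → 0 < p → 0 < q → (c : ℕ) →
    Σ Algorithm λ A → Σ ℕ λ k → Σ ℕ λ C → Solves A p q c k C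
theorem3 p q 0<p 0<q c = solvable p q 0<q c (2 ^ (2 * c + 44)) ≤-refl (q ≤? p)
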